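{- A real $\alpha\in(0,1)$ is left-c.e. speedable if and only if it is covered by a Solovay test that has bounded increments.
   Context: Conventions: "real" means a real number in the open interval $(0,1)$. An approximation of a real $\alpha$ is a sequence $\{a_s\}_{s\in\omega}$ of rational numbers in $[0,1]$ converging to $\alpha$. It is computable if $a_s$ can be computed from $s$. A computable approximation is left-c.e. if it is nondecreasing. A computable order is a computable function $f:\mathbb N\to\mathbb N$ that is nondecreasing and unbounded. Let $\{a_s\}_{s\in\omega}$ be a computable approximation of $\alpha$ and let $\rho\in[0,1)$ be rational. The approximation is $\rho$-speedable if either $\alpha$ is rational, or $\alpha$ is irrational and there is a computable order $f$ with $$\liminf_{s\to\infty}\left|\frac{\alpha-a_{f(s)}}{\alpha-a_s}\right|\le\rho .$$ It is speedable if it is $\rho$-speedable for some $\rho\in[0,1)$. A real is left-c.e. speedable if it has a left-c.e. approximation that is speedable. Solovay tests: a Solovay test is a sequence $\{[\ell_i,r_i]\}_{i\in\omega}$ of nonempty closed intervals (so $0\le \ell_i\le r_i\le 1$) such that $\{\ell_i\}_{i\in\omega}$ and $\{r_i\}_{i\in\omega}$ are computable sequences of dyadic rationals in $[0,1]$ and $\sum_i(r_i-\ell_i)<\infty$. A real $\gamma$ is covered by the test if $\gamma\in[\ell_i,r_i]$ for infinitely many $i$. The test has bounded increments if for some rational constant $d>0$ it holds for all $i$ that $\ell_{i+1}\ge \ell_i+d(r_i-\ell_i)$. -}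

module Defs where

open import Data.Fin using (Fin)
open import Data.Integer as ℤ using (ℤ; +_)
open import Data.Nat as ℕ using (ℕ; zero; suc)
import Data.Nat.Properties as ℕ
open import Data.Product using (Σ; Σ-syntax; ∃; ∃-syntax; _×_; _,_; proj₁; proj₂)
open import Data.Rational as ℚ using (ℚ; 0ℚ; 1ℚ; ½)
import Data.Rational.Properties as ℚ
open import Data.Rational.Solver using (module +-*-Solver)
open import Data.Sum using (_⊎_; inj₁; inj₂)
open import Data.Vec using (Vec; []; _∷_; lookup)
open import Data.Vec.Relation.Binary.Pointwise.Inductive using (Pointwise)
open import Relation.Binary.PropositionalEquality
  using (_≡_; _≢_; refl; sym; trans; cong; cong₂; subst; subst₂)
open import Relation.Nullary using (yes; no; contradiction)

------------------------------------------------------------------------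
-- Sequences

Eventually : (ℕ → Set) → Set
Eventually P = ∃[ N ] (∀ n → N ℕ.≤ n → P n)

InfinitelyOften : (ℕ → Set) → Set
InfinitelyOften P = ∀ N → ∃[ n ] (N ℕ.≤ n × P n)

------------------------------------------------------------------------
-- Computability: Kleene's partial recursive functions, with big-step
-- evaluation as a relation

data Rec : ℕ → Set where
  zer  : ∀ {n} → Rec n
  succ : Rec 1
  proj : ∀ {n} → Fin n → Rec n
  comp : ∀ {k n} → Rec k → Vec (Rec n) k → Rec n
  prec : ∀ {n} → Rec n → Rec (suc (suc n)) → Rec (suc n)
  mu   : ∀ {n} → Rec (suc n) → Rec n

infix 4 _[_]⇓_

data _[_]⇓_ : ∀ {n} → Rec n → Vec ℕ n → ℕ → Set where
  ⇓zer    : ∀ {n} {xs : Vec ℕ n} → zer [ xs ]⇓ 0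
  ⇓succ   : ∀ {x} → succ [ x ∷ [] ]⇓ suc x
  ⇓proj   : ∀ {n} {xs : Vec ℕ n} (i : Fin n) → proj i [ xs ]⇓ lookup xs i
  ⇓comp   : ∀ {k n} {f : Rec k} {gs : Vec (Rec n) k} {xs : Vec ℕ n} {ys z} →
            Pointwise (λ g y → g [ xs ]⇓ y) gs ys →
            f [ ys ]⇓ z → comp f gs [ xs ]⇓ z
  ⇓prec-z : ∀ {n} {f : Rec n} {g} {xs : Vec ℕ n} {z} →
            f [ xs ]⇓ z → prec f g [ 0 ∷ xs ]⇓ z
  ⇓prec-s : ∀ {n} {f : Rec n} {g} {xs : Vec ℕ n} {m y z} →
            prec f g [ m ∷ xs ]⇓ y → g [ m ∷ y ∷ xs ]⇓ z →
            prec f g [ suc m ∷ xs ]⇓ z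
  -- As usual, f must be defined (and nonzero) at all arguments below the
  -- first zero.
  ⇓mu     : ∀ {n} {f : Rec (suc n)} {xs : Vec ℕ n} {m} →
            f [ m ∷ xs ]⇓ 0 →
            (∀ {i} → i ℕ.< m → ∃[ v ] (f [ i ∷ xs ]⇓ suc v)) →
            mu f [ xs ]⇓ m

Computable : (ℕ → ℕ) → Set
Computable f = ∃[ c ] (∀ n → c [ n ∷ [] ]⇓ f n)

-- A sequence of rationals is computable if its terms are (p - q) / (d + 1)
-- for computable p, q, d : ℕ → ℕ; no lowest terms are required.
Computableℚ : (ℕ → ℚ) → Set
Computableℚ a =
  Σ[ p ∈ (ℕ → ℕ) ] Σ[ q ∈ (ℕ → ℕ) ] Σ[ d ∈ (ℕ → ℕ) ]
    (Computable p × Computable q × Computable d ×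
     (∀ s → a s ≡ (p s ℤ.⊖ q s) ℚ./ suc (d s)))

record ComputableOrder (f : ℕ → ℕ) : Set where
  field
    computable    : Computable f
    nondecreasing : ∀ {m n} → m ℕ.≤ n → f m ℕ.≤ f n
    unbounded     : ∀ b → ∃[ n ] (b ℕ.< f n)

Dyadic : ℚ → Set
Dyadic q = ∃[ k ] ∃[ m ] (q ≡ ℚ._/_ k (2 ℕ.^ m) {{ℕ.m^n≢0 2 m}})

InUnitInterval : ℚ → Set
InUnitInterval q = 0ℚ ℚ.≤ q × q ℚ.≤ 1ℚ

------------------------------------------------------------------------
-- Real numbers: Cauchy sequences of rationals, compared up to _≃ℝ_

Cauchy : (ℕ → ℚ) → Set
Cauchy x = ∀ ε → 0ℚ ℚ.< ε →
  ∃[ N ] (∀ m n → N ℕ.≤ m → N ℕ.≤ n → ℚ.∣ x m ℚ.- x n ∣ ℚ.< ε)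

record ℝ : Set where
  constructor mkℝ
  field
    seq    : ℕ → ℚ
    cauchy : Cauchy seq

open ℝ public

infix 4 _<ℝ_ _≤ℝ_ _≃ℝ_ _≄ℝ_

_<ℝ_ : ℝ → ℝ → Set
x <ℝ y = ∃[ ε ] (0ℚ ℚ.< ε × Eventually (λ n → seq x n ℚ.+ ε ℚ.≤ seq y n))

_≤ℝ_ : ℝ → ℝ → Set
x ≤ℝ y = ∀ ε → 0ℚ ℚ.< ε → Eventually (λ n → seq x n ℚ.≤ seq y n ℚ.+ ε)

_≃ℝ_ : ℝ → ℝ → Set
x ≃ℝ y = ∀ ε → 0ℚ ℚ.< ε → Eventually (λ n → ℚ.∣ seq x n ℚ.- seq y n ∣ ℚ.≤ ε)

-- Distinctness of reals in the positive sense; classically it is the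
-- negation of _≃ℝ_.
_≄ℝ_ : ℝ → ℝ → Set
x ≄ℝ y = x <ℝ y ⊎ y <ℝ x

open +-*-Solver

abstract
  half-pos : ∀ ε → 0ℚ ℚ.< ε → 0ℚ ℚ.< ½ ℚ.* ε
  half-pos ε 0<ε = subst (ℚ._< ½ ℚ.* ε) (ℚ.*-zeroʳ ½) (ℚ.*-monoʳ-<-pos ½ 0<ε)

  halves : ∀ ε → ½ ℚ.* ε ℚ.+ ½ ℚ.* ε ≡ ε
  halves ε = trans (sym (ℚ.*-distribʳ-+ ε ½ ½)) (ℚ.*-identityˡ ε)

  *-pos : ∀ {p q} → 0ℚ ℚ.< p → 0ℚ ℚ.< q → 0ℚ ℚ.< p ℚ.* q
  *-pos {p} {q} 0<p 0<q =
    subst (ℚ._< p ℚ.* q) (ℚ.*-zeroʳ p)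
      (ℚ.*-monoʳ-<-pos p {{ℚ.positive 0<p}} 0<q)

  *-mono-abs : ∀ {p q r s} → ℚ.∣ p ∣ ℚ.≤ q → ℚ.∣ r ∣ ℚ.≤ s →
               ℚ.∣ p ∣ ℚ.* ℚ.∣ r ∣ ℚ.≤ q ℚ.* s
  *-mono-abs {p} {q} {r} {s} p≤q r≤s = ℚ.≤-trans
    (ℚ.*-monoʳ-≤-nonNeg ℚ.∣ r ∣ {{ℚ.∣-∣-nonNeg r}} p≤q)
    (ℚ.*-monoˡ-≤-nonNeg q {{ℚ.nonNegative (ℚ.≤-trans (ℚ.0≤∣p∣ p) p≤q)}} r≤s)

  p≤∣p∣ : ∀ p → p ℚ.≤ ℚ.∣ p ∣
  p≤∣p∣ p with ℚ.≤-total 0ℚ p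
  ... | inj₁ 0≤p = ℚ.≤-reflexive (sym (ℚ.0≤p⇒∣p∣≡p 0≤p))
  ... | inj₂ p≤0 = ℚ.≤-trans p≤0 (ℚ.0≤∣p∣ p)

  ∣p∣-∣q∣≤∣p-q∣ : ∀ p q → ℚ.∣ p ∣ ℚ.- ℚ.∣ q ∣ ℚ.≤ ℚ.∣ p ℚ.- q ∣
  ∣p∣-∣q∣≤∣p-q∣ p q = subst (ℚ.∣ p ∣ ℚ.- ℚ.∣ q ∣ ℚ.≤_)
    (solve 2 (λ a b → (a :+ b) :- b := a) refl ℚ.∣ p ℚ.- q ∣ ℚ.∣ q ∣)
    (ℚ.+-monoˡ-≤ (ℚ.- ℚ.∣ q ∣)
      (subst (λ t → ℚ.∣ t ∣ ℚ.≤ ℚ.∣ p ℚ.- q ∣ ℚ.+ ℚ.∣ q ∣)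
        (solve 2 (λ a b → (a :- b) :+ b := a) refl p q)
        (ℚ.∣p+q∣≤∣p∣+∣q∣ (p ℚ.- q) q)))

  ∣∣p∣-∣q∣∣≤∣p-q∣ : ∀ p q → ℚ.∣ ℚ.∣ p ∣ ℚ.- ℚ.∣ q ∣ ∣ ℚ.≤ ℚ.∣ p ℚ.- q ∣
  ∣∣p∣-∣q∣∣≤∣p-q∣ p q with ℚ.∣p∣≡p∨∣p∣≡-p (ℚ.∣ p ∣ ℚ.- ℚ.∣ q ∣)
  ... | inj₁ eq = subst (ℚ._≤ ℚ.∣ p ℚ.- q ∣) (sym eq) (∣p∣-∣q∣≤∣p-q∣ p q)
  ... | inj₂ eq = subst₂ ℚ._≤_
      (sym (trans eq (solve 2 (λ a b → :- (a :- b) := b :- a) refl ℚ.∣ p ∣ ℚ.∣ q ∣)))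
      (trans (cong ℚ.∣_∣ (solve 2 (λ a b → b :- a := :- (a :- b)) refl p q))
             (ℚ.∣-p∣≡∣p∣ (p ℚ.- q)))
      (∣p∣-∣q∣≤∣p-q∣ q p)

-- The value at 0 is a convention, used only at finitely many terms of a
-- sequence bounded away from 0.
recip : ℚ → ℚ
recip q with q ℚ.≟ 0ℚ
... | yes _  = 0ℚ
... | no q≢0 = (ℚ.1/ q) {{ℚ.≢-nonZero q≢0}}

abstract
  recip-inverse : ∀ q → q ≢ 0ℚ → q ℚ.* recip q ≡ 1ℚ
  recip-inverse q q≢0 with q ℚ.≟ 0ℚ
  ... | yes q≡0 = contradiction q≡0 q≢0
  ... | no  ¬0  = ℚ.*-inverseʳ q {{ℚ.≢-nonZero ¬0}}

  bounded : ∀ x → Cauchy x →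
            ∃[ B ] (0ℚ ℚ.< B × Eventually (λ n → ℚ.∣ x n ∣ ℚ.≤ B))
  bounded x cx with cx 1ℚ (ℚ.positive⁻¹ 1ℚ)
  ... | N , h = 1ℚ ℚ.+ ℚ.∣ x N ∣ ,
      ℚ.+-mono-<-≤ (ℚ.positive⁻¹ 1ℚ) (ℚ.0≤∣p∣ (x N)) ,
      N , λ n N≤n → subst (λ t → ℚ.∣ t ∣ ℚ.≤ 1ℚ ℚ.+ ℚ.∣ x N ∣)
        (solve 2 (λ a b → (a :- b) :+ b := a) refl (x n) (x N))
        (ℚ.≤-trans (ℚ.∣p+q∣≤∣p∣+∣q∣ (x n ℚ.- x N) (x N))
          (ℚ.+-monoˡ-≤ ℚ.∣ x N ∣ (ℚ.<⇒≤ (h n N N≤n ℕ.≤-refl))))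

  cauchy-+ : ∀ x y → Cauchy x → Cauchy y → Cauchy (λ n → x n ℚ.+ y n)
  cauchy-+ x y cx cy ε 0<ε
    with cx (½ ℚ.* ε) (half-pos ε 0<ε) | cy (½ ℚ.* ε) (half-pos ε 0<ε)
  ... | N , h | M , k = N ℕ.⊔ M , λ m n m≥ n≥ →
    subst (λ t → ℚ.∣ t ∣ ℚ.< ε)
      (solve 4 (λ a b c d → (a :- c) :+ (b :- d) := (a :+ b) :- (c :+ d))
        refl (x m) (y m) (x n) (y n))
      (ℚ.≤-<-trans (ℚ.∣p+q∣≤∣p∣+∣q∣ (x m ℚ.- x n) (y m ℚ.- y n))
        (subst (_ ℚ.<_) (halves ε)
          (ℚ.+-mono-<
            (h m n (ℕ.m⊔n≤o⇒m≤o N M m≥) (ℕ.m⊔n≤o⇒m≤o N M n≥))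
            (k m n (ℕ.m⊔n≤o⇒n≤o N M m≥) (ℕ.m⊔n≤o⇒n≤o N M n≥)))))

  cauchy-neg : ∀ x → Cauchy x → Cauchy (λ n → ℚ.- x n)
  cauchy-neg x cx ε 0<ε with cx ε 0<ε
  ... | N , h = N , λ m n m≥ n≥ →
    subst (ℚ._< ε)
      (trans (sym (ℚ.∣-p∣≡∣p∣ (x m ℚ.- x n)))
        (cong ℚ.∣_∣ (solve 2 (λ a b → :- (a :- b) := (:- a) :- (:- b))
          refl (x m) (x n))))
      (h m n m≥ n≥)

  cauchy-abs : ∀ x → Cauchy x → Cauchy (λ n → ℚ.∣ x n ∣)
  cauchy-abs x cx ε 0<ε with cx ε 0<ε
  ... | N , h = N , λ m n m≥ n≥ →
    ℚ.≤-<-trans (∣∣p∣-∣q∣∣≤∣p-q∣ (x m) (x n)) (h m n m≥ n≥)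

  scaled : ∀ {p q B η} → 0ℚ ℚ.< B → ℚ.∣ p ∣ ℚ.≤ B →
           ℚ.∣ q ∣ ℚ.< η ℚ.* recip B → ℚ.∣ p ℚ.* q ∣ ℚ.< η
  scaled {p} {q} {B} {η} 0<B p≤B q< =
    subst (ℚ._< η) (sym (ℚ.∣p*q∣≡∣p∣*∣q∣ p q))
      (ℚ.≤-<-trans (*-mono-abs {p} {B} {q} p≤B ℚ.≤-refl)
        (subst (B ℚ.* ℚ.∣ q ∣ ℚ.<_) eq
          (ℚ.*-monoʳ-<-pos B {{ℚ.positive 0<B}} q<)))
    where
    eq : B ℚ.* (η ℚ.* recip B) ≡ η
    eq = trans (solve 3 (λ b e r → b :* (e :* r) := e :* (b :* r))
                  refl B η (recip B))
           (trans (cong (η ℚ.*_)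
                    (recip-inverse B (λ B≡0 → ℚ.<⇒≢ 0<B (sym B≡0))))
             (ℚ.*-identityʳ η))

  recip-pos : ∀ {q} → 0ℚ ℚ.< q → 0ℚ ℚ.< recip q
  recip-pos {q} 0<q =
    ℚ.*-cancelˡ-<-nonNeg q {{ℚ.nonNegative (ℚ.<⇒≤ 0<q)}}
      (subst₂ ℚ._<_ (sym (ℚ.*-zeroʳ q))
        (sym (recip-inverse q (λ q≡0 → ℚ.<⇒≢ 0<q (sym q≡0))))
        (ℚ.positive⁻¹ 1ℚ))

  product-difference : ∀ a b c d →
    a ℚ.* (b ℚ.- d) ℚ.+ d ℚ.* (a ℚ.- c) ≡ a ℚ.* b ℚ.- c ℚ.* d
  product-difference = solve 4
    (λ a b c d → a :* (b :- d) :+ d :* (a :- c) := a :* b :- c :* d) refl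

  product-close : ∀ a b c d {B C} η → 0ℚ ℚ.< B → 0ℚ ℚ.< C →
    ℚ.∣ a ∣ ℚ.≤ B → ℚ.∣ d ∣ ℚ.≤ C →
    ℚ.∣ b ℚ.- d ∣ ℚ.< η ℚ.* recip B → ℚ.∣ a ℚ.- c ∣ ℚ.< η ℚ.* recip C →
    ℚ.∣ a ℚ.* b ℚ.- c ℚ.* d ∣ ℚ.< η ℚ.+ η
  product-close a b c d {B} {C} η 0<B 0<C a≤B d≤C bd ac =
    subst (λ t → ℚ.∣ t ∣ ℚ.< η ℚ.+ η) (product-difference a b c d)
      (ℚ.≤-<-trans (ℚ.∣p+q∣≤∣p∣+∣q∣ (a ℚ.* (b ℚ.- d)) (d ℚ.* (a ℚ.- c)))
        (ℚ.+-mono-<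
          (scaled {a} {b ℚ.- d} {B} {η} 0<B a≤B bd)
          (scaled {d} {a ℚ.- c} {C} {η} 0<C d≤C ac)))

  cauchy-* : ∀ x y → Cauchy x → Cauchy y → Cauchy (λ n → x n ℚ.* y n)
  cauchy-* x y cx cy ε 0<ε =
    let η = ½ ℚ.* ε
        0<η = half-pos ε 0<ε
        B , 0<B , K , hB = bounded x cx
        C , 0<C , L , hC = bounded y cy
        M , hy = cy (η ℚ.* recip B) (*-pos {η} {recip B} 0<η (recip-pos {B} 0<B))
        N , hx = cx (η ℚ.* recip C) (*-pos {η} {recip C} 0<η (recip-pos {C} 0<C))
        KL : ∀ {i} → (K ℕ.⊔ L) ℕ.⊔ (M ℕ.⊔ N) ℕ.≤ i → K ℕ.⊔ L ℕ.≤ i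
        KL = ℕ.m⊔n≤o⇒m≤o (K ℕ.⊔ L) (M ℕ.⊔ N)
        MN : ∀ {i} → (K ℕ.⊔ L) ℕ.⊔ (M ℕ.⊔ N) ℕ.≤ i → M ℕ.⊔ N ℕ.≤ i
        MN = ℕ.m⊔n≤o⇒n≤o (K ℕ.⊔ L) (M ℕ.⊔ N)
    in (K ℕ.⊔ L) ℕ.⊔ (M ℕ.⊔ N) , λ m n m≥ n≥ →
      subst (ℚ.∣ x m ℚ.* y m ℚ.- x n ℚ.* y n ∣ ℚ.<_) (halves ε)
        (product-close (x m) (y m) (x n) (y n) {B} {C} η 0<B 0<C
          (hB m (ℕ.m⊔n≤o⇒m≤o K L (KL m≥)))
          (hC n (ℕ.m⊔n≤o⇒n≤o K L (KL n≥)))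
          (hy m n (ℕ.m⊔n≤o⇒m≤o M N (MN m≥)) (ℕ.m⊔n≤o⇒m≤o M N (MN n≥)))
          (hx m n (ℕ.m⊔n≤o⇒n≤o M N (MN m≥)) (ℕ.m⊔n≤o⇒n≤o M N (MN n≥))))

  cauchy-recip : ∀ x → Cauchy x → ∀ e → 0ℚ ℚ.< e →
                 Eventually (λ n → e ℚ.≤ ℚ.∣ x n ∣) → Cauchy (λ n → recip (x n))
  cauchy-recip x cx e 0<e (K , away) ε 0<ε =
    let N , h = cx (ε ℚ.* (e ℚ.* e)) (*-pos {ε} {e ℚ.* e} 0<ε (*-pos {e} {e} 0<e 0<e))
    in K ℕ.⊔ N , λ m n m≥ n≥ →
      est (x m) (x n) (away m (ℕ.m⊔n≤o⇒m≤o K N m≥)) (away n (ℕ.m⊔n≤o⇒m≤o K N n≥))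
        (h n m (ℕ.m⊔n≤o⇒n≤o K N n≥) (ℕ.m⊔n≤o⇒n≤o K N m≥))
    where
    nz : ∀ a → e ℚ.≤ ℚ.∣ a ∣ → a ≢ 0ℚ
    nz a e≤ refl = ℚ.<-irrefl refl (ℚ.<-≤-trans 0<e e≤)

    est : ∀ a b → e ℚ.≤ ℚ.∣ a ∣ → e ℚ.≤ ℚ.∣ b ∣ →
          ℚ.∣ b ℚ.- a ∣ ℚ.< ε ℚ.* (e ℚ.* e) → ℚ.∣ recip a ℚ.- recip b ∣ ℚ.< ε
    est a b e≤a e≤b close =
      ℚ.*-cancelˡ-<-nonNeg ℚ.∣ a ℚ.* b ∣ {{ℚ.∣-∣-nonNeg (a ℚ.* b)}}
        (subst (ℚ._< ℚ.∣ a ℚ.* b ∣ ℚ.* ε) lhs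
          (ℚ.<-≤-trans close
            (subst (ε ℚ.* (e ℚ.* e) ℚ.≤_) (ℚ.*-comm ε ℚ.∣ a ℚ.* b ∣)
              (ℚ.*-monoˡ-≤-nonNeg ε {{ℚ.nonNegative (ℚ.<⇒≤ 0<ε)}}
                (subst (e ℚ.* e ℚ.≤_) (sym (ℚ.∣p*q∣≡∣p∣*∣q∣ a b))
                  (ℚ.≤-trans
                    (ℚ.*-monoʳ-≤-nonNeg e {{ℚ.nonNegative (ℚ.<⇒≤ 0<e)}} e≤a)
                    (ℚ.*-monoˡ-≤-nonNeg ℚ.∣ a ∣ {{ℚ.∣-∣-nonNeg a}} e≤b)))))))
      where
      ident : b ℚ.- a ≡ (a ℚ.* b) ℚ.* (recip a ℚ.- recip b)
      ident = sym (trans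
        (solve 4 (λ a b r s → (a :* b) :* (r :- s) := b :* (a :* r) :- a :* (b :* s))
          refl a b (recip a) (recip b))
        (cong₂ ℚ._-_
          (trans (cong (b ℚ.*_) (recip-inverse a (nz a e≤a))) (ℚ.*-identityʳ b))
          (trans (cong (a ℚ.*_) (recip-inverse b (nz b e≤b))) (ℚ.*-identityʳ a))))
      lhs : ℚ.∣ b ℚ.- a ∣ ≡ ℚ.∣ a ℚ.* b ∣ ℚ.* ℚ.∣ recip a ℚ.- recip b ∣
      lhs = trans (cong ℚ.∣_∣ ident)
              (ℚ.∣p*q∣≡∣p∣*∣q∣ (a ℚ.* b) (recip a ℚ.- recip b))

infixl 6 _+ℝ_ _-ℝ_
infixl 7 _*ℝ_
infix  8 -ℝ_

ofℚ : ℚ → ℝ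
ofℚ q = mkℝ (λ _ → q) λ ε 0<ε →
  0 , λ _ _ _ _ → subst (ℚ._< ε) (cong ℚ.∣_∣ (sym (ℚ.+-inverseʳ q))) 0<ε

0ℝ 1ℝ : ℝ
0ℝ = ofℚ 0ℚ
1ℝ = ofℚ 1ℚ

_+ℝ_ : ℝ → ℝ → ℝ
x +ℝ y = mkℝ (λ n → seq x n ℚ.+ seq y n)
             (cauchy-+ (seq x) (seq y) (cauchy x) (cauchy y))

-ℝ_ : ℝ → ℝ
-ℝ x = mkℝ (λ n → ℚ.- seq x n) (cauchy-neg (seq x) (cauchy x))

_-ℝ_ : ℝ → ℝ → ℝ
x -ℝ y = x +ℝ (-ℝ y)

_*ℝ_ : ℝ → ℝ → ℝ
x *ℝ y = mkℝ (λ n → seq x n ℚ.* seq y n)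
             (cauchy-* (seq x) (seq y) (cauchy x) (cauchy y))

∣_∣ℝ : ℝ → ℝ
∣ x ∣ℝ = mkℝ (λ n → ℚ.∣ seq x n ∣) (cauchy-abs (seq x) (cauchy x))

abstract
  away-from-0 : ∀ x → x ≄ℝ 0ℝ →
                ∃[ e ] (0ℚ ℚ.< e × Eventually (λ n → e ℚ.≤ ℚ.∣ seq x n ∣))
  away-from-0 x (inj₁ (e , 0<e , N , h)) = e , 0<e , N , λ n N≤n →
    ℚ.≤-trans
      (subst (ℚ._≤ ℚ.- seq x n)
        (solve 2 (λ a b → (a :+ b) :- a := b) refl (seq x n) e)
        (subst (seq x n ℚ.+ e ℚ.- seq x n ℚ.≤_) (ℚ.+-identityˡ (ℚ.- seq x n))
          (ℚ.+-monoˡ-≤ (ℚ.- seq x n) (h n N≤n))))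
      (subst (ℚ.- seq x n ℚ.≤_) (ℚ.∣-p∣≡∣p∣ (seq x n)) (p≤∣p∣ (ℚ.- seq x n)))
  away-from-0 x (inj₂ (e , 0<e , N , h)) = e , 0<e , N , λ n N≤n →
    ℚ.≤-trans (subst (ℚ._≤ seq x n) (ℚ.+-identityˡ e) (h n N≤n)) (p≤∣p∣ (seq x n))

inverse : ∀ x → x ≄ℝ 0ℝ → ℝ
inverse x x≄0 = mkℝ (λ n → recip (seq x n)) (cauchy-recip (seq x) (cauchy x) _
  (proj₁ (proj₂ (away-from-0 x x≄0))) (proj₂ (proj₂ (away-from-0 x x≄0))))

divide : ∀ x y → y ≄ℝ 0ℝ → ℝ
divide x y y≄0 = x *ℝ inverse y y≄0

syntax divide x y y≄0 = x ÷ℝ y [ y≄0 ]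

abstract
  ≄ℝ⇒-≄ℝ0 : ∀ x y → x ≄ℝ y → (x -ℝ y) ≄ℝ 0ℝ
  ≄ℝ⇒-≄ℝ0 x y (inj₁ (e , 0<e , N , h)) = inj₁ (e , 0<e , N , λ n N≤n →
    subst (λ t → t ℚ.≤ 0ℚ)
      (solve 3 (λ a b c → (a :+ c) :- b := (a :- b) :+ c) refl (seq x n) (seq y n) e)
      (subst (seq x n ℚ.+ e ℚ.- seq y n ℚ.≤_) (ℚ.+-inverseʳ (seq y n))
        (ℚ.+-monoˡ-≤ (ℚ.- seq y n) (h n N≤n))))
  ≄ℝ⇒-≄ℝ0 x y (inj₂ (e , 0<e , N , h)) = inj₂ (e , 0<e , N , λ n N≤n →
    subst (λ t → t ℚ.≤ seq x n ℚ.- seq y n)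
      (solve 2 (λ b c → (b :+ c) :- b := con 0ℚ :+ c) refl (seq y n) e)
      (ℚ.+-monoˡ-≤ (ℚ.- seq y n) (h n N≤n)))

Rational : ℝ → Set
Rational α = ∃[ q ] (α ≃ℝ ofℚ q)

-- Distinct from every rational in the sense of _≄ℝ_, so that one may divide by
-- α - q; classically the same as ¬ Rational α.
Irrational : ℝ → Set
Irrational α = ∀ q → α ≄ℝ ofℚ q

ConvergesTo : (ℕ → ℚ) → ℝ → Set
ConvergesTo a α = ∀ ε → 0ℚ ℚ.< ε →
  Eventually (λ s → ∣ α -ℝ ofℚ (a s) ∣ℝ <ℝ ofℚ ε)

record IsLimInf (u : ℕ → ℝ) (L : ℝ) : Set where
  field
    eventually-above : ∀ ε → 0ℚ ℚ.< ε → Eventually (λ n → L -ℝ ofℚ ε <ℝ u n)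
    infinitely-often-below : ∀ ε → 0ℚ ℚ.< ε → InfinitelyOften (λ n → u n <ℝ L +ℝ ofℚ ε)

-- For sequences bounded below, such as absolute values, the liminf is a real
-- or +∞, and the latter is excluded by a finite upper bound.
LimInfAtMost : (ℕ → ℝ) → ℚ → Set
LimInfAtMost u ρ = ∃[ L ] (IsLimInf u L × L ≤ℝ ofℚ ρ)

------------------------------------------------------------------------
-- Speedability

record IsApproximation (α : ℝ) (a : ℕ → ℚ) : Set where
  field
    inUnitInterval : ∀ s → InUnitInterval (a s)
    converges      : ConvergesTo a α

record IsLeftCEApproximation (α : ℝ) (a : ℕ → ℚ) : Set where
  field
    isApproximation : IsApproximation α a
    computable      : Computableℚ a
    nondecreasing   : ∀ {s t} → s ℕ.≤ t → a s ℚ.≤ a t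

speedRatio : (α : ℝ) (a : ℕ → ℚ) → Irrational α → (ℕ → ℕ) → ℕ → ℝ
speedRatio α a irr f s =
  ∣ (α -ℝ ofℚ (a (f s))) ÷ℝ (α -ℝ ofℚ (a s)) [ ≄ℝ⇒-≄ℝ0 α (ofℚ (a s)) (irr (a s)) ] ∣ℝ

-- Meant for a computable approximation a of α.
IsSpeedableBy : ℚ → ℝ → (ℕ → ℚ) → Set
IsSpeedableBy ρ α a =
  Rational α ⊎
  (Σ[ irr ∈ Irrational α ] Σ[ f ∈ (ℕ → ℕ) ]
    (ComputableOrder f × LimInfAtMost (speedRatio α a irr f) ρ))

IsSpeedable : ℝ → (ℕ → ℚ) → Set
IsSpeedable α a = ∃[ ρ ] (0ℚ ℚ.≤ ρ × ρ ℚ.< 1ℚ × IsSpeedableBy ρ α a)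

LeftCESpeedable : ℝ → Set
LeftCESpeedable α =
  Σ[ a ∈ (ℕ → ℚ) ] (IsLeftCEApproximation α a × IsSpeedable α a)

------------------------------------------------------------------------
-- Solovay tests

partialSum : (ℕ → ℚ) → ℕ → ℚ
partialSum u zero    = 0ℚ
partialSum u (suc n) = partialSum u n ℚ.+ u n

record SolovayTest : Set where
  field
    ℓ r          : ℕ → ℚ
    ℓ-computable : Computableℚ ℓ
    r-computable : Computableℚ r
    ℓ-dyadic     : ∀ i → Dyadic (ℓ i)
    r-dyadic     : ∀ i → Dyadic (r i)
    0≤ℓ          : ∀ i → 0ℚ ℚ.≤ ℓ i
    ℓ≤r          : ∀ i → ℓ i ℚ.≤ r i
    r≤1          : ∀ i → r i ℚ.≤ 1ℚ
    -- The terms are nonnegative, so the series converges iff its partial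
    -- sums are bounded.
    finite-sum   : ∃[ B ] (∀ n → partialSum (λ i → r i ℚ.- ℓ i) n ℚ.≤ B)

open SolovayTest public

IsCoveredBy : ℝ → SolovayTest → Set
IsCoveredBy γ T = InfinitelyOften (λ i → ofℚ (ℓ T i) ≤ℝ γ × γ ≤ℝ ofℚ (r T i))

HasBoundedIncrements : SolovayTest → Set
HasBoundedIncrements T =
  ∃[ d ] (0ℚ ℚ.< d × (∀ i → ℓ T i ℚ.+ d ℚ.* (r T i ℚ.- ℓ T i) ℚ.≤ ℓ T (suc i)))

{-# OPTIONS --safe #-}

-- From a test to speedability, the left endpoints ℓ increase to α, and whenever
-- [ℓ i , r i] covers α, bounded increments give
-- α - ℓ (i + 1) ≤ (1 - d) (α - ℓ i), so ℓ is speedable via i ↦ i + 1.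
--
-- Conversely, a ratio below some σ < 1 at s means α ≤ a s + C (a (f s) - a s)
-- with C = 1 / (1 - σ). Passing to the orbit of s ↦ s + f s + 1, at the cost of
-- doubling C, one may take f to be the successor: α ≤ b i + C (b (i + 1) - b i)
-- infinitely often. The intervals with ℓ = b i and length C (b (i + 1) - b i)
-- then have increments bounded by 1 / C, and it remains to round b i down to a
-- dyadic. Subtracting 3 · 2⁻ⁱ before that makes the new sequence rise by at least
-- 2⁻ⁱ at each step, which absorbs the rounding errors into a larger constant.
module Submission where

open import Axiom.ExcludedMiddle using (ExcludedMiddle)
open import Data.Fin using (zero; suc)
open import Data.Integer as ℤ using (+_; _⊖_)
import Data.Integer.Properties as ℤ
open import Data.Nat as ℕ using (ℕ; zero; suc)
import Data.Nat.DivMod as ℕ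
import Data.Nat.Properties as ℕ
open import Data.Product using (Σ-syntax; ∃-syntax; _×_; _,_; proj₁; proj₂)
open import Data.Rational as ℚ using (ℚ; 0ℚ; 1ℚ; ½; _+_; _*_; _-_; _≤_; _<_; -_; _/_)
import Data.Rational.Properties as ℚ
open import Data.Rational.Solver using (module +-*-Solver)
import Data.Rational.Unnormalised as ℚᵘ
import Data.Rational.Unnormalised.Properties as ℚᵘ
open import Data.Sum using (_⊎_; inj₁; inj₂)
open import Data.Vec using ([]; _∷_)
open import Data.Vec.Relation.Binary.Pointwise.Inductive using ([]; _∷_)
open import Function using (_∘_)
open import Function.Bundles using (_⇔_; mk⇔)
open import Level using (0ℓ)
open import Relation.Binary.PropositionalEquality
  using (_≡_; refl; sym; trans; cong; cong₂; subst; subst₂)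
open import Relation.Nullary using (¬_; Dec; yes; no; contradiction)
open import Defs

open +-*-Solver

-- Rationals

0≤+ : ∀ {p q} → 0ℚ ≤ p → 0ℚ ≤ q → 0ℚ ≤ p + q
0≤+ 0≤p 0≤q = ℚ.+-mono-≤ 0≤p 0≤q

0≤* : ∀ {p q} → 0ℚ ≤ p → 0ℚ ≤ q → 0ℚ ≤ p * q
0≤* {p} {q} 0≤p 0≤q = subst (_≤ p * q) (ℚ.*-zeroʳ p)
  (ℚ.*-monoˡ-≤-nonNeg p {{ℚ.nonNegative 0≤p}} 0≤q)

gap : ∀ {p q} → p ≤ q → 0ℚ ≤ q - p
gap {p} {q} p≤q = subst (_≤ q - p) (ℚ.+-inverseʳ p) (ℚ.+-monoˡ-≤ (- p) p≤q)

-- Inequalities are proved by writing the difference as a nonnegative expression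
-- in the hypotheses, which leaves a ring identity for the solver.
by-gap : ∀ {p q r} → 0ℚ ≤ r → p + r ≡ q → p ≤ q
by-gap {p} 0≤r refl = subst (_≤ p + _) (ℚ.+-identityʳ p) (ℚ.+-monoʳ-≤ p 0≤r)

gap< : ∀ {p q} → p < q → 0ℚ < q - p
gap< {p} {q} p<q = subst (_< q - p) (ℚ.+-inverseʳ p) (ℚ.+-monoˡ-< (- p) p<q)

by-gap< : ∀ {p q r} → 0ℚ < r → p + r ≡ q → p < q
by-gap< {p} 0<r refl = subst (_< p + _) (ℚ.+-identityʳ p) (ℚ.+-monoʳ-< p 0<r)

≤-<-connex : ∀ p q → p ≤ q ⊎ q < p
≤-<-connex p q with p ℚ.≤? q
... | yes p≤q = inj₁ p≤q
... | no  p≰q = inj₂ (ℚ.≰⇒> p≰q)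

<⇒≱ : ∀ {p q} → p < q → ¬ (q ≤ p)
<⇒≱ p<q q≤p = ℚ.<-irrefl refl (ℚ.<-≤-trans p<q q≤p)

toℚᵘ-/ : ∀ i d → ℚ.toℚᵘ (i / suc d) ℚᵘ.≃ ℚᵘ.mkℚᵘ i d
toℚᵘ-/ i d = ℚ.toℚᵘ-fromℚᵘ (ℚᵘ.mkℚᵘ i d)

-- Abstract, as unfolding normalised fractions makes conversion checking blow up.
abstract
  ι : ℕ → ℚ
  ι n = + n / 1

  ι-0 : ι 0 ≡ 0ℚ
  ι-0 = refl

  ι-1 : ι 1 ≡ 1ℚ
  ι-1 = refl

  ι-2 : ι 2 ≡ + 2 / 1
  ι-2 = refl

  ι-3 : ι 3 ≡ + 3 / 1
  ι-3 = refl

  ι-4 : ι 4 ≡ + 4 / 1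
  ι-4 = refl

  ι-+ : ∀ m n → ι (m ℕ.+ n) ≡ ι m + ι n
  ι-+ m n = ℚ.toℚᵘ-injective (ℚᵘ.≃-trans (toℚᵘ-/ (+ (m ℕ.+ n)) 0)
    (ℚᵘ.≃-trans (ℚᵘ.*≡* (cong (ℤ._* ℤ.1ℤ) (sym (cong₂ ℤ._+_ (ℤ.*-identityʳ (+ m)) (ℤ.*-identityʳ (+ n))))))
    (ℚᵘ.≃-trans (ℚᵘ.+-cong (ℚᵘ.≃-sym (toℚᵘ-/ (+ m) 0)) (ℚᵘ.≃-sym (toℚᵘ-/ (+ n) 0)))
      (ℚᵘ.≃-sym (ℚ.toℚᵘ-homo-+ (ι m) (ι n))))))

  ι-* : ∀ m n → ι (m ℕ.* n) ≡ ι m * ι n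
  ι-* m n = ℚ.toℚᵘ-injective (ℚᵘ.≃-trans (toℚᵘ-/ (+ (m ℕ.* n)) 0)
    (ℚᵘ.≃-trans (ℚᵘ.*≡* (cong (ℤ._* ℤ.1ℤ) (ℤ.pos-* m n)))
    (ℚᵘ.≃-trans (ℚᵘ.*-cong (ℚᵘ.≃-sym (toℚᵘ-/ (+ m) 0)) (ℚᵘ.≃-sym (toℚᵘ-/ (+ n) 0)))
      (ℚᵘ.≃-sym (ℚ.toℚᵘ-homo-* (ι m) (ι n))))))

  /-ι : ∀ n d .{{_ : ℕ.NonZero d}} → (+ n / d) * ι d ≡ ι n
  /-ι n (suc d) = ℚ.toℚᵘ-injective (ℚᵘ.≃-trans (ℚ.toℚᵘ-homo-* (+ n / suc d) (ι (suc d)))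
    (ℚᵘ.≃-trans (ℚᵘ.*-cong (toℚᵘ-/ (+ n) d) (toℚᵘ-/ (+ suc d) 0))
    (ℚᵘ.≃-trans (ℚᵘ.*≡* eq) (ℚᵘ.≃-sym (toℚᵘ-/ (+ n) 0)))))
    where
    eq : (+ n ℤ.* + suc d) ℤ.* ℤ.1ℤ ≡ + n ℤ.* (+ (suc d ℕ.* 1))
    eq = trans (ℤ.*-identityʳ (+ n ℤ.* + suc d))
      (cong (λ k → + n ℤ.* + k) (sym (ℕ.*-identityʳ (suc d))))

  ι≥0 : ∀ n → 0ℚ ≤ ι n
  ι≥0 n = ℚ.nonNegative⁻¹ (ι n) {{ℚ.normalize-nonNeg n 1}}

  ι-mono : ∀ {m n} → m ℕ.≤ n → ι m ≤ ι n
  ι-mono {m} {n} m≤n = by-gap (ι≥0 (n ℕ.∸ m))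
    (trans (sym (ι-+ m (n ℕ.∸ m))) (cong ι (ℕ.m+[n∸m]≡n m≤n)))

  ι-∸ : ∀ {m n} → n ℕ.≤ m → ι (m ℕ.∸ n) ≡ ι m - ι n
  ι-∸ {m} {n} n≤m = trans (solve 2 (λ x y → x := (y :+ x) :- y) refl (ι (m ℕ.∸ n)) (ι n))
    (cong (_- ι n) (trans (sym (ι-+ n (m ℕ.∸ n))) (cong ι (ℕ.m+[n∸m]≡n n≤m))))

  ι-suc : ∀ n → ι (suc n) ≡ 1ℚ + ι n
  ι-suc n = ι-+ 1 n

  ι>0 : ∀ n → 0ℚ < ι (suc n)
  ι>0 n = ℚ.<-≤-trans (ℚ.positive⁻¹ 1ℚ) (ι-mono (ℕ.s≤s (ℕ.z≤n {n})))

  -- The witness is the denominator: it turns `ε` into its numerator, a positive integer.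
  archimedes : ∀ ε → 0ℚ < ε → ∃[ n ] (1ℚ ≤ ι n * ε)
  archimedes p@(ℚ.mkℚ (+ suc a) d c) 0<ε = suc d ,
    subst (1ℚ ≤_) (trans (sym (/-ι (suc a) (suc d)))
        (trans (cong (_* ι (suc d)) {x = + suc a / suc d} {y = p} (ℚ.↥p/↧p≡p p))
          (ℚ.*-comm p (ι (suc d)))))
      (ι-mono {1} {suc a} (ℕ.s≤s ℕ.z≤n))
  archimedes (ℚ.mkℚ (+ zero) d c) 0<ε = contradiction (ℚ.positive 0<ε) λ where record { pos = () }
  archimedes (ℚ.mkℚ ℤ.-[1+ a ] d c) 0<ε = contradiction (ℚ.positive 0<ε) λ where record { pos = () }

  ι-mono-< : ∀ {m n} → m ℕ.< n → ι m < ι n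
  ι-mono-< {m} {n} m<n = ℚ.<-≤-trans
    (by-gap< (ℚ.positive⁻¹ 1ℚ) (trans (ℚ.+-comm (ι m) 1ℚ) (sym (ι-suc m)))) (ι-mono m<n)

  ι-cancel-< : ∀ {m n} → ι m < ι n → m ℕ.< n
  ι-cancel-< ιm<ιn = ℕ.≰⇒> λ n≤m → <⇒≱ ιm<ιn (ι-mono n≤m)

-- 2⁻ᵏ by recursion, so that each halving unfolds to a product with `½` that the ring solver can
-- read.
δ : ℕ → ℚ
δ zero    = 1ℚ
δ (suc k) = ½ * δ k

δ>0 : ∀ k → 0ℚ < δ k
δ>0 zero    = ℚ.positive⁻¹ 1ℚ
δ>0 (suc k) = half-pos (δ k) (δ>0 k)

δ*2^ : ∀ k → δ k * ι (2 ℕ.^ k) ≡ 1ℚ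
δ*2^ zero    = trans (ℚ.*-identityˡ _) ι-1
δ*2^ (suc k) = trans (cong (δ (suc k) *_) (trans (ι-* 2 (2 ℕ.^ k)) (cong (_* ι (2 ℕ.^ k)) ι-2)))
  (trans (solve 2 (λ d t → (con ½ :* d) :* (con (+ 2 / 1) :* t) := d :* t) refl (δ k) (ι (2 ℕ.^ k)))
    (δ*2^ k))

n≤2^n : ∀ n → n ℕ.≤ 2 ℕ.^ n
n≤2^n zero    = ℕ.z≤n
n≤2^n (suc n) = ℕ.+-mono-≤ (ℕ.m^n>0 2 n) (ℕ.≤-trans (n≤2^n n) (ℕ.≤-reflexive (sym (ℕ.+-identityʳ _))))

archimedean : ∀ W ε → 0ℚ < ε → ∃[ n ] (W ≤ ι n * ε)
archimedean W ε 0<ε with ≤-<-connex W 0ℚ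
... | inj₁ W≤0 = 0 , ℚ.≤-trans W≤0 (0≤* (ι≥0 0) (ℚ.<⇒≤ 0<ε))
... | inj₂ 0<W with archimedes (ε * recip W) (*-pos {ε} {recip W} 0<ε (recip-pos {W} 0<W))
...   | n , h = n , by-gap (0≤* (ℚ.<⇒≤ 0<W) (gap h))
  (trans (solve 4 (λ w n e r → w :+ w :* (n :* (e :* r) :- con 1ℚ) := (w :* r) :* (n :* e)) refl W (ι n) ε (recip W))
    (trans (cong (_* (ι n * ε)) (recip-inverse W (λ W≡0 → ℚ.<⇒≢ 0<W (sym W≡0)))) (ℚ.*-identityˡ _)))

-- If W ≤ n ε, then W ≤ 2ⁿ ε by `n≤2^n`, and `δ n` cancels the power of 2.
δ-small : ∀ W ε → 0ℚ < ε → ∃[ k ] (W * δ k ≤ ε)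
δ-small W ε 0<ε with archimedean W ε 0<ε
... | n , h = n , by-gap {W * δ n} {ε}
  (0≤+ (0≤* (ℚ.<⇒≤ (δ>0 n)) (gap h))
    (0≤* (0≤* (ℚ.<⇒≤ (δ>0 n)) (ℚ.<⇒≤ 0<ε)) (gap (ι-mono (n≤2^n n)))))
  (trans (solve 5 (λ w d n e t → w :* d :+ (d :* (n :* e :- w) :+ d :* e :* (t :- n)) := (d :* t) :* e) refl
      W (δ n) (ι n) ε (ι (2 ℕ.^ n)))
    (trans (cong (_* ε) (δ*2^ n)) (ℚ.*-identityˡ ε)))

δ-antitone : ∀ {i j} → i ℕ.≤ j → δ j ≤ δ i
δ-antitone i≤j = go (ℕ.≤⇒≤′ i≤j)
  where
  go : ∀ {i j} → i ℕ.≤′ j → δ j ≤ δ i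
  go ℕ.≤′-refl = ℚ.≤-refl
  go {i} {suc j} (ℕ.≤′-step p) = ℚ.≤-trans
    (by-gap {½ * δ j} {δ j} (0≤* (ℚ.<⇒≤ (ℚ.positive⁻¹ ½)) (ℚ.<⇒≤ (δ>0 j)))
      (halves (δ j))) (go p)

-- Real numbers

ofℚ-≤-≤ℝ : ∀ {p q α} → p ≤ q → ofℚ q ≤ℝ α → ofℚ p ≤ℝ α
ofℚ-≤-≤ℝ p≤q q≤α ε 0<ε with q≤α ε 0<ε
... | N , h = N , λ n N≤n → ℚ.≤-trans p≤q (h n N≤n)

≤ℝ-≤-ofℚ : ∀ {p q α} → α ≤ℝ ofℚ p → p ≤ q → α ≤ℝ ofℚ q
≤ℝ-≤-ofℚ α≤p p≤q ε 0<ε with α≤p ε 0<ε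
... | N , h = N , λ n N≤n → ℚ.≤-trans (h n N≤n) (ℚ.+-monoˡ-≤ ε p≤q)

-- The sequences are compared at one index N past which each varies by at most η = ε/8. A lead of
-- `y` by more than 3η there would persist as `x <ℝ y` with margin η; otherwise `y` never exceeds
-- `x` by more than 5η past N. Comparing rationals is decidable, so no excluded middle enters.
≮ℝ⇒≥ℝ : ∀ {x y} → ¬ (x <ℝ y) → y ≤ℝ x
≮ℝ⇒≥ℝ {x} {y} x≮y ε 0<ε = N , λ n N≤n → case n N≤n (≤-<-connex (seq y N) (seq x N + (η + η + η)))
  where
  δ₃ = δ 3
  η = δ₃ * ε
  0<η : 0ℚ < η
  0<η = *-pos {δ₃} {ε} (δ>0 3) 0<ε
  cx = cauchy x η 0<η
  cy = cauchy y η 0<η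
  N = proj₁ cx ℕ.⊔ proj₁ cy
  hx : ∀ m n → N ℕ.≤ m → N ℕ.≤ n → seq x m - seq x n ≤ η
  hx m n N≤m N≤n = ℚ.≤-trans (p≤∣p∣ (seq x m - seq x n)) (ℚ.<⇒≤ (proj₂ cx m n
    (ℕ.m⊔n≤o⇒m≤o (proj₁ cx) (proj₁ cy) N≤m) (ℕ.m⊔n≤o⇒m≤o (proj₁ cx) (proj₁ cy) N≤n)))
  hy : ∀ m n → N ℕ.≤ m → N ℕ.≤ n → seq y m - seq y n ≤ η
  hy m n N≤m N≤n = ℚ.≤-trans (p≤∣p∣ (seq y m - seq y n)) (ℚ.<⇒≤ (proj₂ cy m n
    (ℕ.m⊔n≤o⇒n≤o (proj₁ cx) (proj₁ cy) N≤m) (ℕ.m⊔n≤o⇒n≤o (proj₁ cx) (proj₁ cy) N≤n)))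
  case : ∀ n → N ℕ.≤ n → (seq y N ≤ seq x N + (η + η + η)) ⊎ (seq x N + (η + η + η) < seq y N) →
         seq y n ≤ seq x n + ε
  case n N≤n (inj₁ le) = by-gap
    (0≤+ (0≤+ (gap le) (gap (hy n N N≤n ℕ.≤-refl)))
      (0≤+ (gap (hx N n ℕ.≤-refl N≤n)) (0≤+ (0≤+ (ℚ.<⇒≤ 0<η) (ℚ.<⇒≤ 0<η)) (ℚ.<⇒≤ 0<η))))
    (solve 5 (λ xN xn yN yn e → let h = con (½ * (½ * (½ * 1ℚ))) :* e in
      yn :+ (((xN :+ (h :+ h :+ h) :- yN) :+ (h :- (yn :- yN))) :+ ((h :- (xN :- xn)) :+ (h :+ h :+ h)))
        := xn :+ e) refl (seq x N) (seq x n) (seq y N) (seq y n) ε)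
  case n N≤n (inj₂ gt) = contradiction (η , 0<η , N , λ m N≤m → by-gap
    (0≤+ (ℚ.<⇒≤ (gap< gt)) (0≤+ (gap (hx m N N≤m ℕ.≤-refl)) (gap (hy N m ℕ.≤-refl N≤m))))
    (solve 5 (λ xN xm yN ym h →
      (xm :+ h) :+ ((yN :- (xN :+ (h :+ h :+ h))) :+ ((h :- (xm :- xN)) :+ (h :- (yN :- ym)))) := ym)
      refl (seq x N) (seq x m) (seq y N) (seq y m) η)) x≮y

∣p∣≤ : ∀ {p η} → p ≤ η → - p ≤ η → ℚ.∣ p ∣ ≤ η
∣p∣≤ {p} p≤ -p≤ with ℚ.∣p∣≡p∨∣p∣≡-p p
... | inj₁ eq = subst (_≤ _) (sym eq) p≤
... | inj₂ eq = subst (_≤ _) (sym eq) -p≤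

½<ε : ∀ {ε} → 0ℚ < ε → ½ * ε < ε
½<ε {ε} 0<ε = by-gap< (half-pos ε 0<ε) (halves ε)

<ℝ⇒≱ℝ : ∀ {x y} → x <ℝ y → ¬ (y ≤ℝ x)
<ℝ⇒≱ℝ {x} {y} (e , 0<e , M , h) y≤x with y≤x (½ * e) (half-pos e 0<e)
... | N , k = <⇒≱ (½<ε 0<e) (by-gap
    (0≤+ (gap (h n (ℕ.m≤m⊔n M N))) (gap (k n (ℕ.m≤n⊔m M N))))
    (solve 4 (λ x y e h → e :+ ((y :- (x :+ e)) :+ (x :+ h :- y)) := h) refl
      (seq x n) (seq y n) e (½ * e)))
  where n = M ℕ.⊔ N

≮≯⇒≃ : ∀ {x y} → ¬ (x <ℝ y) → ¬ (y <ℝ x) → x ≃ℝ y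
≮≯⇒≃ {x} {y} x≮y y≮x ε 0<ε with ≮ℝ⇒≥ℝ {x} {y} x≮y ε 0<ε | ≮ℝ⇒≥ℝ {y} {x} y≮x ε 0<ε
... | M , h | N , k = M ℕ.⊔ N , λ n n≥ → ∣p∣≤
  (by-gap (gap (k n (ℕ.m⊔n≤o⇒n≤o M N n≥)))
    (solve 3 (λ x y e → (x :- y) :+ (y :+ e :- x) := e) refl (seq x n) (seq y n) ε))
  (by-gap (gap (h n (ℕ.m⊔n≤o⇒m≤o M N n≥)))
    (solve 3 (λ x y e → (:- (x :- y)) :+ (x :+ e :- y) := e) refl (seq x n) (seq y n) ε))

-- Excluded middle turns the negative notion into the positive apartness that division by α - q
-- requires.
irrational : ExcludedMiddle 0ℓ → ∀ α → ¬ Rational α → Irrational α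
irrational lem α ¬rat q with lem {α <ℝ ofℚ q} | lem {ofℚ q <ℝ α}
... | yes α<q | _       = inj₁ α<q
... | no _    | yes q<α = inj₂ q<α
... | no α≮q  | no q≮α  = contradiction (q , ≮≯⇒≃ {α} {ofℚ q} α≮q q≮α) ¬rat

-- The limit inferior by bisection

module Bisection
  (lem : ExcludedMiddle 0ℓ) (u : ℕ → ℝ) (ρ : ℚ) (0≤ρ : 0ℚ ≤ ρ)
  (u≥0 : ∀ s n → 0ℚ ≤ seq (u s) n)
  (u≤ρ : InfinitelyOften (λ s → Eventually (λ n → seq (u s) n ≤ ρ)))
  where

  -- The liminf is the cut between the rationals where this fails and those where it holds.
  -- Bisection locates the cut, with excluded middle deciding each midpoint.
  Below : ℚ → Set
  Below q = InfinitelyOften (λ s → u s <ℝ ofℚ q)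

  Below-up : ∀ {p q} → p ≤ q → Below p → Below q
  Below-up p≤q below N with below N
  ... | s , N≤s , e , 0<e , M , h = s , N≤s , e , 0<e , M , λ n M≤n → ℚ.≤-trans (h n M≤n) p≤q

  Below-above-ρ : ∀ {q} → ρ < q → Below q
  Below-above-ρ {q} ρ<q N with u≤ρ N
  ... | s , N≤s , M , h = s , N≤s , q - ρ , gap< ρ<q , M , λ n M≤n → by-gap (gap (h n M≤n))
    (solve 3 (λ v q r → (v :+ (q :- r)) :+ (r :- v) := q) refl (seq (u s) n) q ρ)

  ¬Below-0 : ¬ Below 0ℚ
  ¬Below-0 below with below 0
  ... | s , _ , e , 0<e , M , h = <⇒≱ (ℚ.+-mono-≤-< (u≥0 s M) 0<e) (h M ℕ.≤-refl)

  -- Classical contraposition: if `q` is not eventually a lower bound, then past every N some `u s`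
  -- lies strictly below it.
  ¬Below⇒≤ : ∀ {q} → ¬ Below q → Eventually (λ s → ofℚ q ≤ℝ u s)
  ¬Below⇒≤ {q} ¬below with lem {Eventually (λ s → ofℚ q ≤ℝ u s)}
  ... | yes ev = ev
  ... | no ¬ev = contradiction often ¬below
    where
    often : Below q
    often N with lem {∃[ s ] (N ℕ.≤ s × u s <ℝ ofℚ q)}
    ... | yes w = w
    ... | no ¬w = contradiction
      (N , λ s N≤s → ≮ℝ⇒≥ℝ {u s} {ofℚ q} λ u<q → ¬w (s , N≤s , u<q)) ¬ev

  -- Length of the first bracket, which starts at 0; the extra 1 puts its upper end strictly above
  -- ρ, where `Below-above-ρ` applies.
  W : ℚ
  W = ρ + 1ℚ

  0≤W : 0ℚ ≤ W
  0≤W = 0≤+ 0≤ρ (ℚ.<⇒≤ (ℚ.positive⁻¹ 1ℚ))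

  Bracket : ℕ → Set
  Bracket k = ∃[ lo ] (¬ Below lo × Below (lo + W * δ k))

  abstract
    bracket : ∀ k → Bracket k
    bracket zero = 0ℚ , ¬Below-0 , Below-above-ρ
      (by-gap< (ℚ.positive⁻¹ 1ℚ) (solve 1 (λ r → r :+ con 1ℚ := con 0ℚ :+ (r :+ con 1ℚ) :* con 1ℚ) refl ρ))
    bracket (suc k) with bracket k
    ... | lo , ¬b , b with lem {Below (lo + W * δ (suc k))}
    ...   | yes b′ = lo , ¬b , b′
    ...   | no ¬b′ = lo + W * δ (suc k) , ¬b′ , subst Below
      (solve 3 (λ l w d → l :+ w :* d := (l :+ w :* (con ½ :* d)) :+ w :* (con ½ :* d)) refl lo W (δ k)) b

  lo : ℕ → ℚ
  lo k = proj₁ (bracket k)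

  -- `Below` is upward closed, so no point where it fails lies above one where it holds.
  lo≤hi : ∀ m k → lo m ≤ lo k + W * δ k
  lo≤hi m k with ≤-<-connex (lo m) (lo k + W * δ k)
  ... | inj₁ le = le
  ... | inj₂ gt = contradiction (Below-up (ℚ.<⇒≤ gt) (proj₂ (proj₂ (bracket k)))) (proj₁ (proj₂ (bracket m)))

  -- Being one-sided, the bound needs only `n` to be late: `lo m` lies under the upper end of the
  -- bracket at `n`.
  lo-close : ∀ {m n k} → k ℕ.≤ n → lo m - lo n ≤ W * δ k
  lo-close {m} {n} {k} k≤n = by-gap
    (0≤+ (gap (lo≤hi m n)) (0≤* 0≤W (gap (δ-antitone k≤n))))
    (solve 5 (λ a b w d e → (a :- b) :+ ((b :+ w :* d :- a) :+ w :* (e :- d)) := w :* e) refl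
      (lo m) (lo n) W (δ n) (δ k))

  small : ∀ ε → 0ℚ < ε → ∃[ k ] (W * δ k ≤ ½ * ε)
  small ε 0<ε = δ-small W (½ * ε) (half-pos ε 0<ε)

  lo-cauchy : Cauchy lo
  lo-cauchy ε 0<ε = k , λ m n k≤m k≤n → ℚ.≤-<-trans (close m n k≤m k≤n) (½<ε 0<ε)
    where
    k : ℕ
    k = proj₁ (small ε 0<ε)
    flip : ∀ p q → p - q ≡ - (q - p)
    flip = solve 2 (λ a b → a :- b := :- (b :- a)) refl
    close : ∀ m n → k ℕ.≤ m → k ℕ.≤ n → ℚ.∣ lo m - lo n ∣ ≤ ½ * ε
    close m n k≤m k≤n = ∣p∣≤ {lo m - lo n}
      (ℚ.≤-trans (lo-close {m} {n} k≤n) (proj₂ (small ε 0<ε)))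
      (subst (_≤ ½ * ε) (flip (lo n) (lo m)) (ℚ.≤-trans (lo-close {n} {m} k≤m) (proj₂ (small ε 0<ε))))

  L : ℝ
  L = mkℝ lo lo-cauchy

  lo≤ρ : ∀ k → lo k ≤ ρ
  lo≤ρ k with ≤-<-connex (lo k) ρ
  ... | inj₁ le = le
  ... | inj₂ gt = contradiction (Below-above-ρ gt) (proj₁ (proj₂ (bracket k)))

  -- `L` exceeds `lo k` by at most ε/2, and `u` is eventually at least `lo k`. The other half of ε
  -- is split between the slack of `≤ℝ` and the margin of `<ℝ`, hence η = ε/4.
  above : ∀ ε → 0ℚ < ε → Eventually (λ n → L -ℝ ofℚ ε <ℝ u n)
  above ε 0<ε = proj₁ lo≤u , λ s N≤s → η , 0<η , proj₁ (proj₂ lo≤u s N≤s η 0<η) , λ n n≥ →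
    arith (lo n) (lo k) (W * δ k) (seq (u s) n) (lo≤hi n k) (proj₂ (small ε 0<ε))
      (proj₂ (proj₂ lo≤u s N≤s η 0<η) n n≥)
    where
    k : ℕ
    k = proj₁ (small ε 0<ε)
    lo≤u : Eventually (λ s → ofℚ (lo k) ≤ℝ u s)
    lo≤u = ¬Below⇒≤ (proj₁ (proj₂ (bracket k)))
    η : ℚ
    η = ½ * (½ * ε)
    0<η : 0ℚ < η
    0<η = half-pos (½ * ε) (half-pos ε 0<ε)
    arith : ∀ l l′ w v → l ≤ l′ + w → w ≤ ½ * ε → l′ ≤ v + η → l - ε + η ≤ v
    arith l l′ w v p q r = by-gap (0≤+ (0≤+ (gap p) (gap q)) (gap r))
      (solve 5 (λ l l′ w e v → (l :- e :+ con ½ :* (con ½ :* e)) :+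
          (((l′ :+ w :- l) :+ (con ½ :* e :- w)) :+ (v :+ con ½ :* (con ½ :* e) :- l′)) := v) refl l l′ w ε v)

  -- The upper end of bracket `k` exceeds the late terms of `L` by at most twice its length, which
  -- is why `small` asks for ε/2.
  below : ∀ ε → 0ℚ < ε → InfinitelyOften (λ n → u n <ℝ L +ℝ ofℚ ε)
  below ε 0<ε N = hit (proj₂ (proj₂ (bracket k)) N)
    where
    k : ℕ
    k = proj₁ (small ε 0<ε)
    arith : ∀ v e l l′ w → v + e ≤ l′ + w → l′ - l ≤ w → w ≤ ½ * ε → v + e ≤ l + ε
    arith v e l l′ w p q r = by-gap (0≤+ (0≤+ (gap p) (gap q)) (0≤+ (gap r) (gap r)))
      (solve 6 (λ v e l l′ w ε → (v :+ e) :+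
          (((l′ :+ w :- (v :+ e)) :+ (w :- (l′ :- l))) :+ ((con ½ :* ε :- w) :+ (con ½ :* ε :- w))) := l :+ ε)
        refl v e l l′ w ε)
    hit : ∃[ s ] (N ℕ.≤ s × u s <ℝ ofℚ (lo k + W * δ k)) → ∃[ s ] (N ℕ.≤ s × u s <ℝ L +ℝ ofℚ ε)
    hit (s , N≤s , e , 0<e , M , g) = s , N≤s , e , 0<e , M ℕ.⊔ k , λ n n≥ →
      arith (seq (u s) n) e (lo n) (lo k) (W * δ k) (g n (ℕ.m⊔n≤o⇒m≤o M k n≥))
        (lo-close {k} {n} {k} (ℕ.m⊔n≤o⇒n≤o M k n≥)) (proj₂ (small ε 0<ε))

  limInfAtMost : LimInfAtMost u ρ
  limInfAtMost = L , record { eventually-above = above ; infinitely-often-below = below } ,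
    λ ε 0<ε → 0 , λ n _ → ℚ.≤-trans (lo≤ρ n) (by-gap (ℚ.<⇒≤ 0<ε) refl)

step-mono : ∀ (a : ℕ → ℚ) → (∀ i → a i ≤ a (suc i)) → ∀ {i j} → i ℕ.≤ j → a i ≤ a j
step-mono a step i≤j = go (ℕ.≤⇒≤′ i≤j)
  where
  go : ∀ {i j} → i ℕ.≤′ j → a i ≤ a j
  go ℕ.≤′-refl     = ℚ.≤-refl
  go (ℕ.≤′-step p) = ℚ.≤-trans (go p) (step _)

-- Computable functions

Computable₂ : (ℕ → ℕ → ℕ) → Set
Computable₂ g = ∃[ c ] (∀ m n → c [ m ∷ n ∷ [] ]⇓ g m n)

∘-computable : ∀ {f g} → Computable f → Computable g → Computable (f ∘ g)
∘-computable (c , hc) (e , he) = comp c (e ∷ []) , λ n → ⇓comp (he n ∷ []) (hc _)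

lift₂ : ∀ {g f h} → Computable₂ g → Computable f → Computable h → Computable (λ n → g (f n) (h n))
lift₂ (c , hc) (e , he) (k , hk) =
  comp c (e ∷ k ∷ []) , λ n → ⇓comp (he n ∷ hk n ∷ []) (hc _ _)

const-computable : ∀ k → Computable (λ _ → k)
const-computable zero    = zer , λ _ → ⇓zer
const-computable (suc k) with const-computable k
... | c , hc = comp succ (c ∷ []) , λ n → ⇓comp (hc n ∷ []) ⇓succ

id-computable : Computable (λ n → n)
id-computable = proj zero , λ _ → ⇓proj zero

suc-computable : Computable suc
suc-computable = succ , λ _ → ⇓succ

pred-computable : Computable ℕ.pred
pred-computable = prec zer (proj zero) , run
  where
  run : ∀ n → prec zer (proj zero) [ n ∷ [] ]⇓ ℕ.pred n
  run zero    = ⇓prec-z ⇓zer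
  run (suc n) = ⇓prec-s (run n) (⇓proj zero)

+-computable : Computable₂ ℕ._+_
+-computable = prec (proj zero) (comp succ (proj (suc zero) ∷ [])) , run
  where
  run : ∀ m n → _ [ m ∷ n ∷ [] ]⇓ m ℕ.+ n
  run zero    n = ⇓prec-z (⇓proj zero)
  run (suc m) n = ⇓prec-s (run m n) (⇓comp (⇓proj (suc zero) ∷ []) ⇓succ)

*-computable : Computable₂ ℕ._*_
*-computable = prec zer (comp (proj₁ +-computable) (proj (suc (suc zero)) ∷ proj (suc zero) ∷ [])) , run
  where
  run : ∀ m n → _ [ m ∷ n ∷ [] ]⇓ m ℕ.* n
  run zero    n = ⇓prec-z ⇓zer
  run (suc m) n = ⇓prec-s (run m n)
    (⇓comp (⇓proj (suc (suc zero)) ∷ ⇓proj (suc zero) ∷ []) (proj₂ +-computable n (m ℕ.* n)))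

-- Iterated predecessor. `prec` recurses on its first argument, here the subtrahend, so the
-- arguments are swapped.
∸-computable : Computable₂ ℕ._∸_
∸-computable = comp flipped (proj (suc zero) ∷ proj zero ∷ []) ,
  λ m n → ⇓comp (⇓proj (suc zero) ∷ ⇓proj zero ∷ []) (run n m)
  where
  flipped : Rec 2
  flipped = prec (proj zero) (comp (proj₁ pred-computable) (proj (suc zero) ∷ []))
  run : ∀ n m → flipped [ n ∷ m ∷ [] ]⇓ m ℕ.∸ n
  run zero    m = ⇓prec-z (⇓proj zero)
  run (suc n) m = ⇓prec-s (run n m) (⇓comp (⇓proj (suc zero) ∷ [])
    (subst (proj₁ pred-computable [ m ℕ.∸ n ∷ [] ]⇓_) (ℕ.pred[m∸n]≡m∸[1+n] m n)
      (proj₂ pred-computable (m ℕ.∸ n))))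

m⊓n≡m∸[m∸n] : ∀ m n → m ℕ.⊓ n ≡ m ℕ.∸ (m ℕ.∸ n)
m⊓n≡m∸[m∸n] m n with ℕ.≤-total m n
... | inj₁ m≤n = trans (ℕ.m≤n⇒m⊓n≡m m≤n) (cong (m ℕ.∸_) (sym (ℕ.m≤n⇒m∸n≡0 m≤n)))
... | inj₂ n≤m = trans (ℕ.m≥n⇒m⊓n≡n n≤m) (sym (ℕ.m∸[m∸n]≡n n≤m))

⊓-computable : Computable₂ ℕ._⊓_
⊓-computable = comp c (proj zero ∷ comp c (proj zero ∷ proj (suc zero) ∷ []) ∷ []) ,
  λ m n → subst (comp c (proj zero ∷ comp c (proj zero ∷ proj (suc zero) ∷ []) ∷ []) [ m ∷ n ∷ [] ]⇓_)
    (sym (m⊓n≡m∸[m∸n] m n))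
    (⇓comp (⇓proj zero ∷ ⇓comp (⇓proj zero ∷ ⇓proj (suc zero) ∷ []) (proj₂ ∸-computable m n) ∷ [])
      (proj₂ ∸-computable m (m ℕ.∸ n)))
  where
  c : Rec 2
  c = proj₁ ∸-computable

iterate : (ℕ → ℕ) → ℕ → ℕ
iterate g zero    = 0
iterate g (suc n) = g (iterate g n)

iterate-computable : ∀ {g} → Computable g → Computable (iterate g)
iterate-computable {g} (c , hc) = prec zer (comp c (proj (suc zero) ∷ [])) , run
  where
  run : ∀ n → _ [ n ∷ [] ]⇓ iterate g n
  run zero    = ⇓prec-z ⇓zer
  run (suc n) = ⇓prec-s (run n) (⇓comp (⇓proj (suc zero) ∷ []) (hc (iterate g n)))

2^-computable : Computable (2 ℕ.^_)
2^-computable = prec (proj₁ (const₀ 1)) (comp (proj₁ *-computable) (two ∷ proj (suc zero) ∷ [])) , run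
  where
  -- For a unary function the base case of `prec` takes no arguments, whereas `const-computable`
  -- yields unary programs.
  const₀ : ∀ k → ∃[ c ] (c [ [] ]⇓ k)
  const₀ zero    = zer , ⇓zer
  const₀ (suc k) = comp succ (proj₁ (const₀ k) ∷ []) , ⇓comp (proj₂ (const₀ k) ∷ []) ⇓succ
  two : Rec 2
  two = comp succ (comp succ (zer ∷ []) ∷ [])
  run : ∀ n → prec (proj₁ (const₀ 1)) (comp (proj₁ *-computable) (two ∷ proj (suc zero) ∷ [])) [ n ∷ [] ]⇓ 2 ℕ.^ n
  run zero    = ⇓prec-z (proj₂ (const₀ 1))
  run (suc n) = ⇓prec-s (run n) (⇓comp (⇓comp (⇓comp (⇓zer ∷ []) ⇓succ ∷ []) ⇓succ ∷ ⇓proj (suc zero) ∷ [])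
    (proj₂ *-computable 2 (2 ℕ.^ n)))

n<[1+n/d]*d : ∀ n d → n ℕ.< suc (n ℕ./ suc d) ℕ.* suc d
n<[1+n/d]*d n d = subst (ℕ._< suc (n ℕ./ suc d) ℕ.* suc d) (sym (ℕ.m≡m%n+[m/n]*n n (suc d)))
  (ℕ.+-monoˡ-< ((n ℕ./ suc d) ℕ.* suc d) (ℕ.m%n<n n (suc d)))

-- n / (d + 1) is the least k with n < (k + 1)(d + 1).
/-computable : Computable₂ (λ n d → n ℕ./ suc d)
/-computable = mu test , λ n d → ⇓mu
    (subst (test [ n ℕ./ suc d ∷ n ∷ d ∷ [] ]⇓_) (ℕ.m≤n⇒m∸n≡0 (n<[1+n/d]*d n d)) (run (n ℕ./ suc d) n d))
    (λ {i} i<q → n ℕ.∸ suc i ℕ.* suc d , subst (test [ i ∷ n ∷ d ∷ [] ]⇓_)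
      (ℕ.+-∸-assoc 1 (ℕ.≤-trans (ℕ.*-monoˡ-≤ (suc d) i<q) (ℕ.m/n*n≤m n (suc d)))) (run i n d))
  where
  test : Rec 3
  test = comp (proj₁ ∸-computable)
    (comp succ (proj (suc zero) ∷ []) ∷
     comp (proj₁ *-computable) (comp succ (proj zero ∷ []) ∷ comp succ (proj (suc (suc zero)) ∷ []) ∷ []) ∷ [])
  run : ∀ k n d → test [ k ∷ n ∷ d ∷ [] ]⇓ suc n ℕ.∸ suc k ℕ.* suc d
  run k n d = ⇓comp
    (⇓comp (⇓proj (suc zero) ∷ []) ⇓succ ∷
     ⇓comp (⇓comp (⇓proj zero ∷ []) ⇓succ ∷ ⇓comp (⇓proj (suc (suc zero)) ∷ []) ⇓succ ∷ [])
       (proj₂ *-computable (suc k) (suc d)) ∷ [])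
    (proj₂ ∸-computable (suc n) (suc k ℕ.* suc d))

-- From a test to speedability

suc-order : ComputableOrder suc
suc-order = record
  { computable    = suc-computable
  ; nondecreasing = ℕ.s≤s
  ; unbounded     = λ b → b , ℕ.≤-refl
  }

-- The bound d ≤ ½ keeps the speedability constant 1 - d nonnegative; `fromTest` reduces to it.
module FromTest
  (α : ℝ) (T : SolovayTest) (covered : IsCoveredBy α T)
  (d : ℚ) (0<d : 0ℚ < d) (d≤½ : d ≤ ½)
  (inc : ∀ i → ℓ T i + d * (r T i - ℓ T i) ≤ ℓ T (suc i))
  where

  0≤d : 0ℚ ≤ d
  0≤d = ℚ.<⇒≤ 0<d

  ℓ-mono : ∀ {i j} → i ℕ.≤ j → ℓ T i ≤ ℓ T j
  ℓ-mono = step-mono (ℓ T) λ i → ℚ.≤-trans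
    (by-gap (0≤* 0≤d (gap (ℓ≤r T i))) refl) (inc i)

  ℓ≤α : ∀ i → ofℚ (ℓ T i) ≤ℝ α
  ℓ≤α i with covered i
  ... | j , i≤j , ℓ≤ , _ = ofℚ-≤-≤ℝ {α = α} (ℓ-mono i≤j) ℓ≤

  -- Each covering interval longer than ε raises ℓ by more than d ε, which
  -- happens only boundedly often.
  climb : ∀ ε → 0ℚ < ε → ∀ k →
    (∃[ i ] (α ≤ℝ ofℚ (ℓ T i + ε))) ⊎ (∃[ i ] (ι k * (d * ε) ≤ ℓ T i))
  climb ε 0<ε zero = inj₂ (0 , subst (_≤ ℓ T 0)
    (sym (trans (cong (_* (d * ε)) ι-0) (ℚ.*-zeroˡ (d * ε)))) (0≤ℓ T 0))
  climb ε 0<ε (suc k) with climb ε 0<ε k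
  ... | inj₁ close = inj₁ close
  ... | inj₂ (i , h) with covered i
  ...   | j , i≤j , _ , α≤r with ≤-<-connex (r T j) (ℓ T j + ε)
  ...     | inj₁ short = inj₁ (j , ≤ℝ-≤-ofℚ {α = α} α≤r short)
  ...     | inj₂ long  = inj₂ (suc j , subst (_≤ ℓ T (suc j)) (cong (_* (d * ε)) (sym (ι-suc k)))
    (by-gap (0≤+ (0≤+ (gap (inc j)) (0≤* 0≤d (gap (ℚ.<⇒≤ long)))) (0≤+ (gap (ℓ-mono i≤j)) (gap h)))
      (solve 7 (λ k d e i j r j′ → (con 1ℚ :+ k) :* (d :* e) :+
          (((j′ :- (j :+ d :* (r :- j))) :+ d :* (r :- (j :+ e))) :+ ((j :- i) :+ (i :- k :* (d :* e)))) := j′)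
        refl (ι k) d ε (ℓ T i) (ℓ T j) (r T j) (ℓ T (suc j)))))

  α-close : ∀ ε → 0ℚ < ε → ∃[ i ] (α ≤ℝ ofℚ (ℓ T i + ε))
  α-close ε 0<ε = conclude (climb ε 0<ε k)
    where
    k : ℕ
    -- All left endpoints are at most 1, so none can reach k d ε ≥ 2, and `climb` must stop at a
    -- close index.
    k = proj₁ (archimedean (+ 2 / 1) (d * ε) (*-pos {d} {ε} 0<d 0<ε))
    2≤kdε : + 2 / 1 ≤ ι k * (d * ε)
    2≤kdε = proj₂ (archimedean (+ 2 / 1) (d * ε) (*-pos {d} {ε} 0<d 0<ε))
    conclude : (∃[ i ] (α ≤ℝ ofℚ (ℓ T i + ε))) ⊎ (∃[ i ] (ι k * (d * ε) ≤ ℓ T i)) →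
      ∃[ i ] (α ≤ℝ ofℚ (ℓ T i + ε))
    conclude (inj₁ close)   = close
    conclude (inj₂ (i , h)) = contradiction
      (ℚ.≤-trans (ℚ.≤-trans 2≤kdε h) (ℚ.≤-trans (ℓ≤r T i) (r≤1 T i)))
      (<⇒≱ (by-gap< (ℚ.positive⁻¹ 1ℚ) refl))

  -- Closeness at one index persists, since `ℓ` increases and stays below α. A quarter of ε goes to
  -- `α-close`, a quarter to the slack of `≤ℝ`, and the remaining half is the margin of `<ℝ`.
  converges : ConvergesTo (ℓ T) α
  converges ε 0<ε = i , λ s i≤s → ½ * ε , half-pos ε 0<ε , M ℕ.⊔ N s , λ n n≥ →
    arith (seq α n) (ℓ T i) (ℓ T s) (ℓ-mono i≤s)
      (proj₂ α≤ n (ℕ.m⊔n≤o⇒m≤o M (N s) n≥))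
      (proj₂ (ℓ≤α s (½ * ε) (half-pos ε 0<ε)) n (ℕ.m⊔n≤o⇒n≤o M (N s) n≥))
    where
    η : ℚ
    η = ½ * (½ * ε)
    0<η : 0ℚ < η
    0<η = half-pos (½ * ε) (half-pos ε 0<ε)
    i : ℕ
    i = proj₁ (α-close η 0<η)
    α≤ : Eventually (λ n → seq α n ≤ ℓ T i + η + η)
    α≤ = proj₂ (α-close η 0<η) η 0<η
    M : ℕ
    M = proj₁ α≤
    N : ℕ → ℕ
    N s = proj₁ (ℓ≤α s (½ * ε) (half-pos ε 0<ε))
    arith : ∀ x l l′ → l ≤ l′ → x ≤ l + η + η → l′ ≤ x + ½ * ε → ℚ.∣ x - l′ ∣ + ½ * ε ≤ ε
    arith x l l′ l≤l′ upper lower = subst (ℚ.∣ x - l′ ∣ + ½ * ε ≤_) (halves ε)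
      (ℚ.+-monoˡ-≤ (½ * ε) (∣p∣≤ {x - l′}
        (by-gap (0≤+ (gap upper) (gap l≤l′))
          (solve 4 (λ x l l′ e → (x :- l′) :+
              ((l :+ con ½ :* (con ½ :* e) :+ con ½ :* (con ½ :* e) :- x) :+ (l′ :- l)) := con ½ :* e)
            refl x l l′ ε))
        (by-gap (gap lower)
          (solve 3 (λ x l h → (:- (x :- l)) :+ (x :+ h :- l) := h) refl x l′ (½ * ε)))))

  leftCE : IsLeftCEApproximation α (ℓ T)
  leftCE = record
    { isApproximation = record
      { inUnitInterval = λ s → 0≤ℓ T s , ℚ.≤-trans (ℓ≤r T s) (r≤1 T s)
      ; converges      = converges }
    ; computable    = ℓ-computable T
    ; nondecreasing = ℓ-mono
    }

  -- As q - p ≥ x - p, the step from `p` to `p′` covers at least the fraction `d` of the distance to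
  -- `x`.
  ratio-bound : ∀ {x p p′ q} → p < x → p′ ≤ x → x ≤ q → p + d * (q - p) ≤ p′ →
    ℚ.∣ (x - p′) * recip (x - p) ∣ ≤ 1ℚ - d
  ratio-bound {x} {p} {p′} {q} p<x p′≤x x≤q step =
    subst (_≤ 1ℚ - d) (sym (ℚ.0≤p⇒∣p∣≡p (0≤* (gap p′≤x) 0≤R))) (by-gap
      (0≤* 0≤R (0≤+ (gap step) (0≤* 0≤d (gap x≤q))))
      (trans (solve 6 (λ x p p′ q d R → (x :- p′) :* R :+ R :* ((p′ :- (p :+ d :* (q :- p))) :+ d :* (q :- x))
            := ((x :- p) :* R) :* (con 1ℚ :- d)) refl x p p′ q d R)
        (trans (cong (_* (1ℚ - d)) (recip-inverse (x - p) λ eq → ℚ.<⇒≢ (gap< p<x) (sym eq)))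
          (ℚ.*-identityˡ (1ℚ - d)))))
    where
    R : ℚ
    R = recip (x - p)
    0≤R : 0ℚ ≤ R
    0≤R = ℚ.<⇒≤ (recip-pos (gap< p<x))

  -- `≤ℝ` compares terms only up to ε. Irrationality makes the three comparisons strict, and strict
  -- ones give the exact inequalities between late terms that `ratio-bound` takes.
  ratio-often : (irr : Irrational α) →
    InfinitelyOften (λ s → Eventually (λ n → seq (speedRatio α (ℓ T) irr suc s) n ≤ 1ℚ - d))
  ratio-often irr N with covered N
  ... | i , N≤i , _ , α≤r with irr (ℓ T i) | irr (ℓ T (suc i)) | irr (r T i)
  ...   | inj₁ α<ℓ | _ | _ = contradiction (ℓ≤α i) (<ℝ⇒≱ℝ {α} {ofℚ (ℓ T i)} α<ℓ)
  ...   | inj₂ _ | inj₁ α<ℓ | _ = contradiction (ℓ≤α (suc i)) (<ℝ⇒≱ℝ {α} {ofℚ (ℓ T (suc i))} α<ℓ)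
  ...   | inj₂ _ | inj₂ _ | inj₂ r<α = contradiction α≤r (<ℝ⇒≱ℝ {ofℚ (r T i)} {α} r<α)
  ...   | inj₂ (e , 0<e , K , hK) | inj₂ (e′ , 0<e′ , K′ , hK′) | inj₁ (e″ , 0<e″ , K″ , hK″) =
    i , N≤i , K ℕ.⊔ K′ ℕ.⊔ K″ , λ n n≥ →
      let n≥′ = ℕ.m⊔n≤o⇒m≤o (K ℕ.⊔ K′) K″ n≥
      in ratio-bound
        (ℚ.<-≤-trans (by-gap< 0<e refl) (hK n (ℕ.m⊔n≤o⇒m≤o K K′ n≥′)))
        (ℚ.≤-trans (by-gap (ℚ.<⇒≤ 0<e′) refl) (hK′ n (ℕ.m⊔n≤o⇒n≤o K K′ n≥′)))
        (ℚ.≤-trans (by-gap (ℚ.<⇒≤ 0<e″) refl) (hK″ n (ℕ.m⊔n≤o⇒n≤o (K ℕ.⊔ K′) K″ n≥)))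
        (inc i)

  0≤1-d : 0ℚ ≤ 1ℚ - d
  0≤1-d = gap (ℚ.≤-trans d≤½ (by-gap (ℚ.<⇒≤ (ℚ.positive⁻¹ ½)) refl))

  speedable : ExcludedMiddle 0ℓ → LeftCESpeedable α
  speedable lem = ℓ T , leftCE , 1ℚ - d , 0≤1-d ,
    by-gap< 0<d (solve 1 (λ d → con 1ℚ :- d :+ d := con 1ℚ) refl d) , byCases lem
    where
    byCases : Dec (Rational α) → IsSpeedableBy (1ℚ - d) α (ℓ T)
    byCases (yes rat) = inj₁ rat
    byCases (no ¬rat) = inj₂ (irr , suc , suc-order , Bisection.limInfAtMost lem
      (speedRatio α (ℓ T) irr suc) (1ℚ - d) 0≤1-d
      (λ s n → ℚ.0≤∣p∣ ((seq α n - ℓ T (suc s)) * recip (seq α n - ℓ T s))) (ratio-often irr))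
      where irr = irrational lem α ¬rat

fromTest : ExcludedMiddle 0ℓ → ∀ α →
  Σ[ T ∈ SolovayTest ] (IsCoveredBy α T × HasBoundedIncrements T) → LeftCESpeedable α
fromTest lem α (T , covered , d , 0<d , inc) with ≤-<-connex d ½
... | inj₁ d≤½ = FromTest.speedable α T covered d 0<d d≤½ inc lem
-- Lengths are nonnegative, so the increment condition survives lowering `d` to ½.
... | inj₂ ½<d = FromTest.speedable α T covered ½ (ℚ.positive⁻¹ ½) ℚ.≤-refl
  (λ i → ℚ.≤-trans (by-gap (0≤* (gap (ℚ.<⇒≤ ½<d)) (gap (ℓ≤r T i)))
    (solve 4 (λ l d r h → l :+ h :* (r :- l) :+ (d :- h) :* (r :- l) := l :+ d :* (r :- l)) refl
      (ℓ T i) d (r T i) ½)) (inc i)) lem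

-- Dyadic rounding

ι-dbl : ∀ n → ι (2 ℕ.* n) ≡ (+ 2 / 1) * ι n
ι-dbl n = trans (ι-* 2 n) (cong (_* ι n) ι-2)

/2^ : ℕ → ℕ → ℚ
/2^ n k = ℚ._/_ (+ n) (2 ℕ.^ k) {{ℕ.m^n≢0 2 k}}

/2^-δ : ∀ n k → /2^ n k ≡ ι n * δ k
/2^-δ n k = trans (sym (trans (cong (x *_) (δ*2^ k)) (ℚ.*-identityʳ x)))
  (trans (solve 3 (λ x d t → x :* (d :* t) := (x :* t) :* d) refl x (δ k) (ι (2 ℕ.^ k)))
    (cong (_* δ k) (/-ι n (2 ℕ.^ k) {{ℕ.m^n≢0 2 k}})))
  where
  x : ℚ
  x = /2^ n k

/2^-computable : ∀ {n k} → Computable n → Computable k → Computableℚ (λ i → /2^ (n i) (k i))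
-- `Computableℚ` writes denominators as successors, hence the predecessor of the power of 2.
/2^-computable {n} {k} cn ck = n , (λ _ → 0) , (λ i → ℕ.pred (2 ℕ.^ k i)) ,
  cn , const-computable 0 , ∘-computable pred-computable (∘-computable 2^-computable ck) ,
  λ i → ℚ./-cong {+ n i} {2 ℕ.^ k i} {+ n i} {suc (ℕ.pred (2 ℕ.^ k i))} {{ℕ.m^n≢0 2 (k i)}} refl
    (sym (ℕ.suc-pred (2 ℕ.^ k i) {{ℕ.m^n≢0 2 (k i)}}))

-- Allows a natural numerator, so that division on ℕ can compute the floor.
⊖/-nonneg : ∀ p q d → 0ℚ ≤ (p ⊖ q) / suc d → ((p ⊖ q) / suc d) ≡ + (p ℕ.∸ q) / suc d
⊖/-nonneg p q d 0≤ with ℕ.≤-<-connex q p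
... | inj₁ q≤p = cong (_/ suc d) (ℤ.⊖-≥ q≤p)
... | inj₂ p<q = contradiction
  (subst (0ℚ ≤_) (trans (cong (_/ suc d) (ℤ.⊖-< p<q)) (neg (q ℕ.∸ p) (ℕ.m<n⇒0<n∸m p<q))) 0≤)
  (<⇒≱ (ℚ.neg-antimono-< (pos (q ℕ.∸ p) (ℕ.m<n⇒0<n∸m p<q))))
  where
  neg : ∀ n → 0 ℕ.< n → (ℤ.- (+ n)) / suc d ≡ - (+ n / suc d)
  neg (suc n) _ = refl
  pos : ∀ n → 0 ℕ.< n → 0ℚ < + n / suc d
  pos (suc n) _ = ℚ.positive⁻¹ _ {{ℚ.normalize-pos (suc n) (suc d)}}

floor-≤ : ∀ n d k → ι ((n ℕ.* 2 ℕ.^ k) ℕ./ suc d) * δ k ≤ + n / suc d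
floor-≤ n d k = ℚ.*-cancelʳ-≤-pos (ι (suc d)) {{ℚ.positive (ι>0 d)}}
  (subst (ι m * δ k * ι (suc d) ≤_) (sym (/-ι n (suc d))) (by-gap
    (0≤* (ℚ.<⇒≤ (δ>0 k)) (gap (ι-mono (ℕ.m/n*n≤m (n ℕ.* 2 ℕ.^ k) (suc d)))))
    (trans (cong₂ (λ a b → ι m * δ k * ι (suc d) + δ k * (a - b)) (ι-* n (2 ℕ.^ k)) (ι-* m (suc d)))
      (trans (solve 5 (λ m e d n t → m :* e :* d :+ e :* (n :* t :- m :* d) := (e :* t) :* n) refl
          (ι m) (δ k) (ι (suc d)) (ι n) (ι (2 ℕ.^ k)))
        (trans (cong (_* ι n) (δ*2^ k)) (ℚ.*-identityˡ (ι n)))))))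
  where
  m : ℕ
  m = (n ℕ.* 2 ℕ.^ k) ℕ./ suc d

<-floor : ∀ n d k → + n / suc d < ι (suc ((n ℕ.* 2 ℕ.^ k) ℕ./ suc d)) * δ k
<-floor n d k = ℚ.*-cancelʳ-<-nonNeg (ι (suc d)) {{ℚ.nonNegative (ι≥0 (suc d))}}
  (subst (_< ι m * δ k * ι (suc d)) (sym (/-ι n (suc d))) (by-gap<
    (*-pos (δ>0 k) (gap< (ι-mono-< (n<[1+n/d]*d (n ℕ.* 2 ℕ.^ k) d))))
    (trans (cong₂ (λ a b → ι n + δ k * (a - b)) (ι-* m (suc d)) (ι-* n (2 ℕ.^ k)))
      (trans (solve 5 (λ m e d n t → n :+ e :* (m :* d :- n :* t) := n :- (e :* t) :* n :+ m :* e :* d) refl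
          (ι m) (δ k) (ι (suc d)) (ι n) (ι (2 ℕ.^ k)))
        (trans (cong (λ z → ι n - z * ι n + ι m * δ k * ι (suc d)) (δ*2^ k))
          (solve 2 (λ n z → n :- con 1ℚ :* n :+ z := z) refl (ι n) (ι m * δ k * ι (suc d))))))))
  where
  m : ℕ
  m = suc ((n ℕ.* 2 ℕ.^ k) ℕ./ suc d)

-- Telescoping: each term is dominated by an increment of `v`.
partialSum-≤ : ∀ (u v : ℕ → ℚ) → 0ℚ ≤ v 0 → (∀ i → u i ≤ v (suc i) - v i) → ∀ n → partialSum u n ≤ v n
partialSum-≤ u v 0≤v₀ u≤ zero    = 0≤v₀
partialSum-≤ u v 0≤v₀ u≤ (suc n) = by-gap (0≤+ (gap (partialSum-≤ u v 0≤v₀ u≤ n)) (gap (u≤ n)))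
  (solve 4 (λ s u v w → (s :+ u) :+ ((v :- s) :+ (w :- v :- u)) := w) refl
    (partialSum u n) (u n) (v n) (v (suc n)))

-- The test of rounded intervals

module Rounding
  (α : ℝ) (0<α : 0ℝ <ℝ α) (α<1 : α <ℝ 1ℝ)
  (b : ℕ → ℚ) (b-computable : Computableℚ b)
  (b-step : ∀ i → b i ≤ b (suc i)) (0≤b : ∀ i → 0ℚ ≤ b i) (b≤α : ∀ i → ofℚ (b i) ≤ℝ α)
  (k : ℕ) (good : InfinitelyOften (λ i → α ≤ℝ ofℚ (b i + ι k * (b (suc i) - b i))))
  where

  b≤1 : ∀ i → b i ≤ 1ℚ
  b≤1 i with ≤-<-connex (b i) 1ℚ
  ... | inj₁ le = le
  ... | inj₂ gt = contradiction (ofℚ-≤-≤ℝ {α = α} (ℚ.<⇒≤ gt) (b≤α i)) (<ℝ⇒≱ℝ {α} {1ℝ} α<1)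

  -- `m i` is the floor of 2ⁱ · b i, computed from the natural numerator `P i`; `num i` lowers it by
  -- three units of 2⁻ⁱ, truncated at 0.
  p q d P m num : ℕ → ℕ
  p = proj₁ b-computable
  q = proj₁ (proj₂ b-computable)
  d = proj₁ (proj₂ (proj₂ b-computable))
  P i = p i ℕ.∸ q i
  m i = (P i ℕ.* 2 ℕ.^ i) ℕ./ suc (d i)
  num i = m i ℕ.∸ 3

  b≡ : ∀ i → b i ≡ + P i / suc (d i)
  b≡ i = trans eq (⊖/-nonneg (p i) (q i) (d i) (subst (0ℚ ≤_) eq (0≤b i)))
    where
    eq : b i ≡ (p i ⊖ q i) / suc (d i)
    eq = proj₂ (proj₂ (proj₂ (proj₂ (proj₂ (proj₂ b-computable))))) i

  num-computable : Computable num
  num-computable = lift₂ ∸-computable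
    (lift₂ /-computable
      (lift₂ *-computable
        (lift₂ ∸-computable (proj₁ (proj₂ (proj₂ (proj₂ b-computable))))
          (proj₁ (proj₂ (proj₂ (proj₂ (proj₂ b-computable))))))
        2^-computable)
      (proj₁ (proj₂ (proj₂ (proj₂ (proj₂ (proj₂ b-computable)))))))
    (const-computable 3)

  m-below : ∀ i → ι (m i) * δ i ≤ b i
  m-below i = subst (ι (m i) * δ i ≤_) (sym (b≡ i)) (floor-≤ (P i) (d i) i)

  m-above : ∀ i → b i < (1ℚ + ι (m i)) * δ i
  m-above i = subst₂ (λ x y → x < y * δ i) (sym (b≡ i)) (ι-suc (m i)) (<-floor (P i) (d i) i)

  -- At scale 2⁻⁽ⁱ⁺¹⁾, `b-step` puts 2 · m i strictly below m (i + 1) + 1, and both are integers.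
  m-dbl : ∀ i → 2 ℕ.* m i ℕ.≤ m (suc i)
  m-dbl i = ℕ.s≤s⁻¹ (ι-cancel-< (ℚ.*-cancelʳ-<-nonNeg (δ (suc i)) {{ℚ.nonNegative (ℚ.<⇒≤ (δ>0 (suc i)))}}
    (subst₂ (λ x y → x * δ (suc i) < y * δ (suc i)) (sym (ι-dbl (m i))) (sym (ι-suc (m (suc i))))
      (subst (_< (1ℚ + ι (m (suc i))) * δ (suc i))
        (solve 2 (λ m d → m :* d := (con (+ 2 / 1) :* m) :* (con ½ :* d)) refl (ι (m i)) (δ i))
        (ℚ.≤-<-trans (ℚ.≤-trans (m-below i) (b-step i)) (m-above (suc i)))))))

  -- Doubling turns the subtracted 3 into 6, so `l` is nondecreasing even where truncation occurs.
  num-dbl : ∀ i → 2 ℕ.* num i ℕ.≤ num (suc i)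
  num-dbl i = subst (ℕ._≤ num (suc i)) (sym (ℕ.*-distribˡ-∸ 2 (m i) 3))
    (ℕ.∸-mono (m-dbl i) (ℕ.m≤m+n 3 3))

  -- Lowering by three units and rounding by less than one lose at most 4 · 2⁻ⁱ, hence the 4.
  k′ : ℕ
  k′ = k ℕ.+ 4

  K : ℚ
  K = ι k′

  K≡ : K ≡ ι k + + 4 / 1
  K≡ = trans (ι-+ k 4) (cong (λ z → ι k + z) ι-4)

  -- Numerator over 2ⁱ⁺¹ of `l i + K * (l (suc i) - l i)`; doubling `num i` brings both left
  -- endpoints to that scale.
  extended : ℕ → ℕ
  extended i = 2 ℕ.* num i ℕ.+ k′ ℕ.* (num (suc i) ℕ.∸ 2 ℕ.* num i)

  -- The minimum cuts the right endpoint off at 1.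
  rnum : ℕ → ℕ
  rnum i = 2 ℕ.^ suc i ℕ.⊓ extended i

  rnum-computable : Computable rnum
  rnum-computable = lift₂ ⊓-computable (∘-computable 2^-computable suc-computable)
    (lift₂ +-computable dbl (lift₂ *-computable (const-computable k′)
      (lift₂ ∸-computable (∘-computable num-computable suc-computable) dbl)))
    where
    dbl : Computable (λ i → 2 ℕ.* num i)
    dbl = lift₂ *-computable (const-computable 2) num-computable

  l t : ℕ → ℚ
  l i = ι (num i) * δ i
  t i = ι (rnum i) * δ (suc i)

  dbl-δ : ∀ i → ι (2 ℕ.* num i) * δ (suc i) ≡ l i
  dbl-δ i = trans (cong (_* δ (suc i)) (ι-dbl (num i)))
    (solve 2 (λ m d → (con (+ 2 / 1) :* m) :* (con ½ :* d) := m :* d) refl (ι (num i)) (δ i))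

  δ-mono : ∀ {m n} i → m ℕ.≤ n → ι m * δ i ≤ ι n * δ i
  δ-mono i m≤n = ℚ.*-monoʳ-≤-nonNeg (δ i) {{ℚ.nonNegative (ℚ.<⇒≤ (δ>0 i))}} (ι-mono m≤n)

  0≤l : ∀ i → 0ℚ ≤ l i
  0≤l i = 0≤* (ι≥0 (num i)) (ℚ.<⇒≤ (δ>0 i))

  l≤b : ∀ i → l i ≤ b i
  l≤b i = ℚ.≤-trans (δ-mono i (ℕ.m∸n≤m (m i) 3)) (m-below i)

  l≤1 : ∀ i → l i ≤ 1ℚ
  l≤1 i = ℚ.≤-trans (l≤b i) (b≤1 i)

  num≤2^ : ∀ i → num i ℕ.≤ 2 ℕ.^ i
  num≤2^ i = ℕ.s≤s⁻¹ (ι-cancel-< (ℚ.≤-<-trans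
    (by-gap (0≤* (ι≥0 (2 ℕ.^ i)) (gap (l≤1 i)))
      (trans (solve 3 (λ n t d → n :+ t :* (con 1ℚ :- n :* d) := n :+ t :- (d :* t) :* n) refl
          (ι (num i)) (ι (2 ℕ.^ i)) (δ i))
        (trans (cong (λ z → ι (num i) + ι (2 ℕ.^ i) - z * ι (num i)) (δ*2^ i))
          (solve 2 (λ n t → n :+ t :- con 1ℚ :* n := t) refl (ι (num i)) (ι (2 ℕ.^ i))))))
    (ι-mono-< (ℕ.n<1+n (2 ℕ.^ i)))))

  2^-δ : ∀ i → ι (2 ℕ.^ i) * δ i ≡ 1ℚ
  2^-δ i = trans (ℚ.*-comm (ι (2 ℕ.^ i)) (δ i)) (δ*2^ i)

  extended-δ : ∀ i → ι (extended i) * δ (suc i) ≡ l i + K * (l (suc i) - l i)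
  extended-δ i = trans (cong (_* δ (suc i)) (trans (ι-+ x (k′ ℕ.* y))
      (cong (λ z → ι x + z) (trans (ι-* k′ y) (cong (K *_) (ι-∸ (num-dbl i)))))))
    (trans (solve 4 (λ x y k d → (x :+ k :* (y :- x)) :* d := x :* d :+ k :* (y :* d :- x :* d)) refl
        (ι x) (ι (num (suc i))) K (δ (suc i)))
      (cong (λ z → z + K * (l (suc i) - z)) (dbl-δ i)))
    where
    x y : ℕ
    x = 2 ℕ.* num i
    y = num (suc i) ℕ.∸ x

  l≤t : ∀ i → l i ≤ t i
  l≤t i = subst (_≤ t i) (dbl-δ i) (δ-mono (suc i)
    (ℕ.⊓-glb (ℕ.*-monoʳ-≤ 2 (num≤2^ i)) (ℕ.m≤m+n (2 ℕ.* num i) _)))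

  t≤1 : ∀ i → t i ≤ 1ℚ
  t≤1 i = subst (t i ≤_) (2^-δ (suc i)) (δ-mono (suc i) (ℕ.m⊓n≤m (2 ℕ.^ suc i) (extended i)))

  t≤ : ∀ i → t i ≤ l i + K * (l (suc i) - l i)
  t≤ i = subst (t i ≤_) (extended-δ i) (δ-mono (suc i) (ℕ.m⊓n≤n (2 ℕ.^ suc i) (extended i)))

  t-length : ∀ i → t i - l i ≤ K * (l (suc i) - l i)
  t-length i = by-gap (gap (t≤ i))
    (solve 3 (λ t l z → (t :- l) :+ (l :+ z :- t) := z) refl (t i) (l i) (K * (l (suc i) - l i)))

  ℓ≡ : ∀ i → /2^ (num i) i ≡ l i
  ℓ≡ i = /2^-δ (num i) i

  r≡ : ∀ i → /2^ (rnum i) (suc i) ≡ t i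
  r≡ i = /2^-δ (rnum i) (suc i)

  test : SolovayTest
  test = record
    { ℓ = λ i → /2^ (num i) i
    ; r = λ i → /2^ (rnum i) (suc i)
    ; ℓ-computable = /2^-computable num-computable id-computable
    ; r-computable = /2^-computable rnum-computable suc-computable
    ; ℓ-dyadic = λ i → + num i , i , refl
    ; r-dyadic = λ i → + rnum i , suc i , refl
    ; 0≤ℓ = λ i → subst (0ℚ ≤_) (sym (ℓ≡ i)) (0≤l i)
    ; ℓ≤r = λ i → subst₂ _≤_ (sym (ℓ≡ i)) (sym (r≡ i)) (l≤t i)
    ; r≤1 = λ i → subst (_≤ 1ℚ) (sym (r≡ i)) (t≤1 i)
    -- The lengths are at most the increments of K · l, and l ≤ 1.
    ; finite-sum = K , λ n → ℚ.≤-trans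
        (partialSum-≤ _ (λ i → K * l i) (0≤* (ι≥0 k′) (0≤l 0))
          (λ i → subst₂ _≤_ (cong₂ _-_ (sym (r≡ i)) (sym (ℓ≡ i)))
            (solve 3 (λ k l l′ → k :* (l′ :- l) := k :* l′ :- k :* l) refl K (l i) (l (suc i)))
            (t-length i)) n)
        (by-gap (0≤* (ι≥0 k′) (gap (l≤1 n)))
          (solve 2 (λ k l → k :* l :+ k :* (con 1ℚ :- l) := k) refl K (l n)))
    }

  0<K : 0ℚ < K
  0<K = subst (0ℚ <_) (sym K≡) (ℚ.+-mono-≤-< (ι≥0 k) (ℚ.positive⁻¹ (+ 4 / 1)))

  bounded-increments : HasBoundedIncrements test
  bounded-increments = recip K , recip-pos 0<K , λ i →
    subst₂ _≤_ (cong₂ (λ x y → x + recip K * (y - x)) (sym (ℓ≡ i)) (sym (r≡ i))) (sym (ℓ≡ (suc i)))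
      (by-gap (0≤* (ℚ.<⇒≤ (recip-pos 0<K)) (gap (t-length i)))
        (trans (solve 5 (λ l l′ t k d → l :+ d :* (t :- l) :+ d :* (k :* (l′ :- l) :- (t :- l)) :=
            l :+ (k :* d) :* (l′ :- l)) refl (l i) (l (suc i)) (t i) K (recip K))
          (trans (cong (λ z → l i + z * (l (suc i) - l i)) (recip-inverse K λ eq → ℚ.<⇒≢ 0<K (sym eq)))
            (solve 2 (λ l l′ → l :+ con 1ℚ :* (l′ :- l) := l′) refl (l i) (l (suc i))))))

  b-mono : ∀ {i j} → i ℕ.≤ j → b i ≤ b j
  b-mono = step-mono b b-step

  -- At a good index with b (i + 1) ≤ 0 the upper bound for α would be at most 0. Positivity is what
  -- later makes `m` reach 3.
  b-positive : ∃[ i ] (0ℚ < b i)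
  b-positive = choose (good 0)
    where
    arith : ∀ k x y → 0ℚ ≤ k → 0ℚ ≤ x → x ≤ y → y ≤ 0ℚ → x + k * (y - x) ≤ 0ℚ
    arith k x y 0≤k 0≤x x≤y y≤0 = by-gap
      (0≤+ (0≤+ (gap y≤0) (gap x≤y)) (0≤* 0≤k (0≤+ (gap y≤0) 0≤x)))
      (solve 3 (λ k x y → (x :+ k :* (y :- x)) :+
        (((con 0ℚ :- y) :+ (y :- x)) :+ k :* ((con 0ℚ :- y) :+ x)) := con 0ℚ) refl k x y)
    choose : ∃[ i ] (0 ℕ.≤ i × α ≤ℝ ofℚ (b i + ι k * (b (suc i) - b i))) → ∃[ i ] (0ℚ < b i)
    choose (i , _ , α≤) = split (≤-<-connex (b (suc i)) 0ℚ)
      where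
      split : b (suc i) ≤ 0ℚ ⊎ 0ℚ < b (suc i) → ∃[ i ] (0ℚ < b i)
      split (inj₂ 0<b)  = suc i , 0<b
      split (inj₁ b′≤0) = contradiction
        (≤ℝ-≤-ofℚ {b i + ι k * (b (suc i) - b i)} {0ℚ} {α} α≤
          (arith (ι k) (b i) (b (suc i)) (ι≥0 k) (0≤b i) (b-step i) b′≤0))
        (<ℝ⇒≱ℝ {0ℝ} {α} 0<α)

  -- From this index on, num is not truncated.
  m-large : Eventually (λ i → 3 ℕ.≤ m i)
  m-large = j ℕ.⊔ h , λ i i≥ → ℕ.<⇒≤ (ℕ.s≤s⁻¹ (ι-cancel-<
    (ℚ.*-cancelʳ-<-nonNeg (δ i) {{ℚ.nonNegative (ℚ.<⇒≤ (δ>0 i))}} {ι 4} {ι (suc (m i))}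
      (subst₂ (λ x y → x * δ i < y * δ i) (sym ι-4) (sym (ι-suc (m i))) (ℚ.≤-<-trans
        (arith (+ 4 / 1) (δ i) (δ h) (b j) (b i) (ℚ.<⇒≤ (ℚ.positive⁻¹ (+ 4 / 1)))
          (δ-antitone (ℕ.m⊔n≤o⇒n≤o j h i≥)) (proj₂ small) (b-mono (ℕ.m⊔n≤o⇒m≤o j h i≥)))
        (m-above i))))))
    where
    j : ℕ
    j = proj₁ b-positive
    small : ∃[ h ] ((+ 4 / 1) * δ h ≤ b j)
    small = δ-small (+ 4 / 1) (b j) (proj₂ b-positive)
    h : ℕ
    h = proj₁ small
    arith : ∀ c d e x y → 0ℚ ≤ c → d ≤ e → c * e ≤ x → x ≤ y → c * d ≤ y
    arith c d e x y 0≤c d≤e ce≤x x≤y = by-gap (0≤+ (0≤* 0≤c (gap d≤e)) (0≤+ (gap ce≤x) (gap x≤y)))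
      (solve 5 (λ c d e x y → c :* d :+ (c :* (e :- d) :+ ((x :- c :* e) :+ (y :- x))) := y) refl c d e x y)

  num-δ : ∀ i → 3 ℕ.≤ m i → l i ≡ (ι (m i) - + 3 / 1) * δ i
  num-δ i 3≤m = cong (_* δ i) (trans (ι-∸ 3≤m) (cong (λ z → ι (m i) - z) ι-3))

  -- With e = 2⁻ⁱ, the left side starts at most 4e above `l i`, and `l` rises by at least (b (i + 1)
  -- - b i) + e. The gain of e per step uses that the lowering shrinks from 3e to 3e/2 while
  -- rounding costs at most e/2. The four extra multiples of the rise repay the 4e.
  b-covers : ∀ i → 3 ℕ.≤ m i → 3 ℕ.≤ m (suc i) →
    b i + ι k * (b (suc i) - b i) ≤ l i + K * (l (suc i) - l i)
  b-covers i 3≤m 3≤m′ = subst₂ (λ x y → b i + ι k * (b (suc i) - b i) ≤ x + K * (y - x))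
    (sym (num-δ i 3≤m)) (sym (num-δ (suc i) 3≤m′))
    (subst (λ K → b i + ι k * (b (suc i) - b i) ≤ x + K * (y - x)) (sym K≡)
      (arith (ι k) (b i) (b (suc i)) (ι (m i)) (ι (m (suc i))) (δ i) (ι≥0 k) (b-step i) (δ>0 i)
        (m-below i) (ℚ.<⇒≤ (m-above i)) (ℚ.<⇒≤ (m-above (suc i)))))
    where
    x y : ℚ
    x = (ι (m i) - + 3 / 1) * δ i
    y = (ι (m (suc i)) - + 3 / 1) * δ (suc i)
    arith : ∀ k b b′ M M′ e → 0ℚ ≤ k → b ≤ b′ → 0ℚ < e →
      M * e ≤ b → b ≤ (1ℚ + M) * e → b′ ≤ (1ℚ + M′) * (½ * e) →
      b + k * (b′ - b) ≤ (M - + 3 / 1) * e +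
        (k + + 4 / 1) * ((M′ - + 3 / 1) * (½ * e) - (M - + 3 / 1) * e)
    arith k b b′ M M′ e 0≤k b≤b′ 0<e h₁ h₂ h₃ = by-gap
      (0≤+ (0≤+ (0≤* 0≤k (0≤+ 0≤s (ℚ.<⇒≤ 0<e)))
                (0≤* (ℚ.<⇒≤ (ℚ.positive⁻¹ (+ 4 / 1))) (0≤+ 0≤s (gap b≤b′)))) (gap h₂))
      (solve 6 (λ k b b′ M M′ e →
        let D = con ½ :* e
            x = (M :- con (+ 3 / 1)) :* e
            y = (M′ :- con (+ 3 / 1)) :* D
            s = (b :- M :* e) :+ ((con 1ℚ :+ M′) :* D :- b′)
        in (b :+ k :* (b′ :- b)) :+ ((k :* (s :+ e) :+ con (+ 4 / 1) :* (s :+ (b′ :- b))) :+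
             ((con 1ℚ :+ M) :* e :- b)) := x :+ (k :+ con (+ 4 / 1)) :* (y :- x))
        refl k b b′ M M′ e)
      where
      0≤s : 0ℚ ≤ (b - M * e) + ((1ℚ + M′) * (½ * e) - b′)
      0≤s = 0≤+ (gap h₁) (gap h₃)

  α≤1 : α ≤ℝ 1ℝ
  α≤1 ε 0<ε = proj₁ below-1 , λ n N≤n →
    ℚ.≤-trans (by-gap (ℚ.<⇒≤ 0<e) refl) (ℚ.≤-trans (proj₂ below-1 n N≤n) (by-gap (ℚ.<⇒≤ 0<ε) refl))
    where
    e : ℚ
    e = proj₁ α<1
    0<e : 0ℚ < e
    0<e = proj₁ (proj₂ α<1)
    below-1 : Eventually (λ n → seq α n + e ≤ 1ℚ)
    below-1 = proj₂ (proj₂ α<1)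

  -- Cutting off at 1 loses nothing, as α ≤ 1; otherwise `b-covers` applies.
  α≤t : ∀ i → 3 ℕ.≤ m i → 3 ℕ.≤ m (suc i) → α ≤ℝ ofℚ (b i + ι k * (b (suc i) - b i)) → α ≤ℝ ofℚ (t i)
  α≤t i 3≤m 3≤m′ α≤ = select (ℕ.⊓-sel (2 ℕ.^ suc i) (extended i))
    where
    select : rnum i ≡ 2 ℕ.^ suc i ⊎ rnum i ≡ extended i → α ≤ℝ ofℚ (t i)
    select (inj₁ eq) = ≤ℝ-≤-ofℚ {1ℚ} {t i} {α} α≤1
      (ℚ.≤-reflexive (sym (trans (cong (λ z → ι z * δ (suc i)) eq) (2^-δ (suc i)))))
    select (inj₂ eq) = ≤ℝ-≤-ofℚ {b i + ι k * (b (suc i) - b i)} {t i} {α} α≤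
      (ℚ.≤-trans (b-covers i 3≤m 3≤m′)
        (ℚ.≤-reflexive (sym (trans (cong (λ z → ι z * δ (suc i)) eq) (extended-δ i)))))

  covered : IsCoveredBy α test
  covered N = cover (good (N ℕ.⊔ M))
    where
    M : ℕ
    M = proj₁ m-large
    cover : ∃[ i ] (N ℕ.⊔ M ℕ.≤ i × α ≤ℝ ofℚ (b i + ι k * (b (suc i) - b i))) →
      ∃[ i ] (N ℕ.≤ i × (ofℚ (ℓ test i) ≤ℝ α × α ≤ℝ ofℚ (r test i)))
    cover (i , i≥ , α≤) = i , ℕ.m⊔n≤o⇒m≤o N M i≥ ,
      ofℚ-≤-≤ℝ {/2^ (num i) i} {b i} {α} (ℚ.≤-trans (ℚ.≤-reflexive (ℓ≡ i)) (l≤b i)) (b≤α i) ,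
      ≤ℝ-≤-ofℚ {t i} {/2^ (rnum i) (suc i)} {α}
        (α≤t i (proj₂ m-large i M≤i) (proj₂ m-large (suc i) (ℕ.m≤n⇒m≤1+n M≤i)) α≤)
        (ℚ.≤-reflexive (sym (r≡ i)))
      where
      M≤i : M ℕ.≤ i
      M≤i = ℕ.m⊔n≤o⇒n≤o N M i≥

-- From speedability to a test

-- The orbit s₀ = 0, s_{j+1} = s_j + f(s_j) + 1 brackets every s with a large
-- gain between s and f(s); then f(s) ≤ s_{j+2}, so one of the two steps after
-- s_j makes at least half of that gain.
module Orbit
  (α : ℝ) (a : ℕ → ℚ) (a-computable : Computableℚ a) (a-mono : ∀ {s t} → s ℕ.≤ t → a s ≤ a t)
  (f : ℕ → ℕ) (f-computable : Computable f) (f-mono : ∀ {s t} → s ℕ.≤ t → f s ℕ.≤ f t)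
  (c : ℕ) (good : InfinitelyOften (λ s → α ≤ℝ ofℚ (a s + ι (suc c) * (a (f s) - a s))))
  where

  next orbit : ℕ → ℕ
  next s = suc (s ℕ.+ f s)
  orbit = iterate next

  orbit-computable : Computable orbit
  orbit-computable = iterate-computable
    (∘-computable suc-computable (lift₂ +-computable id-computable f-computable))

  b : ℕ → ℚ
  b i = a (orbit i)

  b-computable : Computableℚ b
  b-computable = let p , q , d , cp , cq , cd , eq = a-computable in
    p ∘ orbit , q ∘ orbit , d ∘ orbit ,
    ∘-computable cp orbit-computable , ∘-computable cq orbit-computable ,
    ∘-computable cd orbit-computable , λ i → eq (orbit i)

  orbit-step : ∀ i → orbit i ℕ.< orbit (suc i)
  orbit-step i = ℕ.s≤s (ℕ.m≤m+n (orbit i) (f (orbit i)))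

  b-step : ∀ i → b i ≤ b (suc i)
  b-step i = a-mono (ℕ.<⇒≤ (orbit-step i))

  -- Induction on `t`, moving to the next block exactly when `t` reaches its first point.
  locate : ∀ N {t} → orbit N ℕ.≤′ t → ∃[ i ] (N ℕ.≤ i × orbit i ℕ.≤ t × t ℕ.< orbit (suc i))
  locate N ℕ.≤′-refl = N , ℕ.≤-refl , ℕ.≤-refl , orbit-step N
  locate N {suc t} (ℕ.≤′-step p) with locate N p
  ... | i , N≤i , le , lt with ℕ.<-≤-connex (suc t) (orbit (suc i))
  ...   | inj₁ lt′ = i , N≤i , ℕ.m≤n⇒m≤1+n le , lt′
  ...   | inj₂ ge  = suc i , ℕ.m≤n⇒m≤1+n N≤i , ge , ℕ.≤-<-trans lt (orbit-step (suc i))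

  k : ℕ
  k = 2 ℕ.* suc c

  Good : ℕ → Set
  Good i = α ≤ℝ ofℚ (b i + ι k * (b (suc i) - b i))

  -- The bound equals (1 + c) y - c x, which grows with `y` and falls with `x`; hence the constant
  -- in the form 1 + c with c ≥ 0.
  widen : ∀ c x y x′ y′ → 0ℚ ≤ c → x ≤ x′ → y′ ≤ y →
    x′ + (1ℚ + c) * (y′ - x′) ≤ x + (1ℚ + c) * (y - x)
  widen c x y x′ y′ 0≤c x≤x′ y′≤y = by-gap
    (0≤+ (0≤* 0≤c (gap x≤x′)) (0≤* (0≤+ (ℚ.<⇒≤ (ℚ.positive⁻¹ 1ℚ)) 0≤c) (gap y′≤y)))
    (solve 5 (λ c x y x′ y′ → x′ :+ (con 1ℚ :+ c) :* (y′ :- x′) :+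
        (c :* (x′ :- x) :+ (con 1ℚ :+ c) :* (y :- y′)) := x :+ (con 1ℚ :+ c) :* (y :- x)) refl c x y x′ y′)

  first-half : ∀ c x y z → 0ℚ ≤ c → z - y ≤ y - x → x + c * (z - x) ≤ x + (+ 2 / 1) * c * (y - x)
  first-half c x y z 0≤c h = by-gap (0≤* 0≤c (gap h))
    (solve 4 (λ c x y z → x :+ c :* (z :- x) :+ c :* ((y :- x) :- (z :- y)) :=
      x :+ con (+ 2 / 1) :* c :* (y :- x)) refl c x y z)

  second-half : ∀ c x y z → 0ℚ ≤ c → x ≤ y → y - x ≤ z - y → x + c * (z - x) ≤ y + (+ 2 / 1) * c * (z - y)
  second-half c x y z 0≤c x≤y h = by-gap (0≤+ (gap x≤y) (0≤* 0≤c (gap h)))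
    (solve 4 (λ c x y z → x :+ c :* (z :- x) :+ ((y :- x) :+ c :* ((z :- y) :- (y :- x))) :=
      y :+ con (+ 2 / 1) :* c :* (z :- y)) refl c x y z)

  good-b : InfinitelyOften Good
  good-b N = at (good (orbit N))
    where
    C : ℚ
    C = ι (suc c)
    at : ∃[ s ] (orbit N ℕ.≤ s × α ≤ℝ ofℚ (a s + C * (a (f s) - a s))) → ∃[ i ] (N ℕ.≤ i × Good i)
    at (s , N≤s , α≤) = split (≤-<-connex (z - y) (y - x))
      where
      located : ∃[ i ] (N ℕ.≤ i × orbit i ℕ.≤ s × s ℕ.< orbit (suc i))
      located = locate N (ℕ.≤⇒≤′ N≤s)
      i : ℕ
      i = proj₁ located
      x y z : ℚ
      x = b i
      y = b (suc i)
      z = b (suc (suc i))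
      N≤i : N ℕ.≤ i
      N≤i = proj₁ (proj₂ located)
      fs≤ : f s ℕ.≤ orbit (suc (suc i))
      fs≤ = ℕ.≤-trans (f-mono (ℕ.<⇒≤ (proj₂ (proj₂ (proj₂ located)))))
        (ℕ.m≤n⇒m≤1+n (ℕ.m≤n+m (f (orbit (suc i))) (orbit (suc i))))
      α≤₂ : α ≤ℝ ofℚ (x + C * (z - x))
      α≤₂ = ≤ℝ-≤-ofℚ {a s + C * (a (f s) - a s)} {x + C * (z - x)} {α} α≤
        (subst (λ C → a s + C * (a (f s) - a s) ≤ x + C * (z - x)) (sym (ι-suc c))
          (widen (ι c) x z (a s) (a (f s)) (ι≥0 c) (a-mono (proj₁ (proj₂ (proj₂ located)))) (a-mono fs≤)))
      split : z - y ≤ y - x ⊎ y - x < z - y → ∃[ i ] (N ℕ.≤ i × Good i)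
      split (inj₁ h) = i , N≤i , ≤ℝ-≤-ofℚ {x + C * (z - x)} {x + ι k * (y - x)} {α} α≤₂
        (subst (λ K → x + C * (z - x) ≤ x + K * (y - x)) (sym (ι-dbl (suc c)))
          (first-half C x y z (ι≥0 (suc c)) h))
      split (inj₂ h) = suc i , ℕ.m≤n⇒m≤1+n N≤i , ≤ℝ-≤-ofℚ {x + C * (z - x)} {y + ι k * (z - y)} {α} α≤₂
        (subst (λ K → x + C * (z - x) ≤ y + K * (z - y)) (sym (ι-dbl (suc c)))
          (second-half C x y z (ι≥0 (suc c)) (b-step i) (ℚ.<⇒≤ h)))

-- Irrationality leaves only `α <ℝ ofℚ (a s)` to exclude. As `a` is nondecreasing, all later terms
-- would stay a fixed distance above α, against convergence.
leftCE-< : ∀ {α a} → IsLeftCEApproximation α a → Irrational α → ∀ s → ofℚ (a s) <ℝ α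
leftCE-< {α} {a} leftCE irr s = below (irr (a s))
  where
  open IsLeftCEApproximation leftCE
  arith : ∀ x y z e e′ → x + e ≤ y → y ≤ z → ℚ.∣ x - z ∣ + e′ ≤ e → e′ ≤ 0ℚ
  arith x y z e e′ p q h = by-gap
    (0≤+ (0≤+ (gap p) (gap q)) (0≤+ (gap h) (gap (subst (- (x - z) ≤_) (ℚ.∣-p∣≡∣p∣ (x - z)) (p≤∣p∣ (- (x - z)))))))
    (solve 6 (λ x y z e e′ w → e′ :+ (((y :- (x :+ e)) :+ (z :- y)) :+
        ((e :- (w :+ e′)) :+ (w :- (:- (x :- z))))) := con 0ℚ) refl x y z e e′ ℚ.∣ x - z ∣)
  below : α ≄ℝ ofℚ (a s) → ofℚ (a s) <ℝ α
  below (inj₂ a<α) = a<α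
  below (inj₁ (e , 0<e , M , h)) = contradiction
    (arith (seq α n) (a s) (a t) e e′ (h n (ℕ.m≤m⊔n M M′)) (nondecreasing (ℕ.m≤n⊔m N s)) (h′ n (ℕ.m≤n⊔m M M′)))
    (<⇒≱ 0<e′)
    where
    N t : ℕ
    N = proj₁ (IsApproximation.converges isApproximation e 0<e)
    t = N ℕ.⊔ s
    close : ∣ α -ℝ ofℚ (a t) ∣ℝ <ℝ ofℚ e
    close = proj₂ (IsApproximation.converges isApproximation e 0<e) t (ℕ.m≤m⊔n N s)
    e′ : ℚ
    e′ = proj₁ close
    0<e′ : 0ℚ < e′
    0<e′ = proj₁ (proj₂ close)
    M′ n : ℕ
    M′ = proj₁ (proj₂ (proj₂ close))
    n = M ℕ.⊔ M′
    h′ : ∀ n → M′ ℕ.≤ n → ℚ.∣ seq α n - a t ∣ + e′ ≤ e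
    h′ = proj₂ (proj₂ (proj₂ close))

-- The rational case

constℚ-computable : ∀ q → Computableℚ (λ _ → q)
constℚ-computable q@(ℚ.mkℚ (+ k) d _) = (λ _ → k) , (λ _ → 0) , (λ _ → d) ,
  const-computable k , const-computable 0 , const-computable d , λ _ → sym (ℚ.↥p/↧p≡p q)
constℚ-computable q@(ℚ.mkℚ ℤ.-[1+ k ] d _) = (λ _ → 0) , (λ _ → suc k) , (λ _ → d) ,
  const-computable 0 , const-computable (suc k) , const-computable d , λ _ → sym (ℚ.↥p/↧p≡p q)

BoundedIncrementTest : ℝ → Set
BoundedIncrementTest α = Σ[ T ∈ SolovayTest ] (IsCoveredBy α T × HasBoundedIncrements T)

-- As `q` may fail to be dyadic, the intervals cannot simply be the point `q`. The constant sequence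
-- `q` with factor 0 satisfies the hypotheses of `Rounding`.
rational⇒test : ∀ α → 0ℝ <ℝ α → α <ℝ 1ℝ → Rational α → BoundedIncrementTest α
rational⇒test α 0<α α<1 (q , α≃q) = R.test , R.covered , R.bounded-increments
  where
  upper : ∀ x ε → ℚ.∣ x - q ∣ ≤ ε → x ≤ q + ε
  upper x ε h = by-gap (gap (ℚ.≤-trans (p≤∣p∣ (x - q)) h))
    (solve 3 (λ x q e → x :+ (e :- (x :- q)) := q :+ e) refl x q ε)
  lower : ∀ x ε → ℚ.∣ x - q ∣ ≤ ε → q ≤ x + ε
  lower x ε h = by-gap (gap (ℚ.≤-trans (subst (- (x - q) ≤_) (ℚ.∣-p∣≡∣p∣ (x - q)) (p≤∣p∣ (- (x - q)))) h))
    (solve 3 (λ x q e → q :+ (e :- (:- (x :- q))) := x :+ e) refl x q ε)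
  α≤q : α ≤ℝ ofℚ q
  α≤q ε 0<ε = proj₁ (α≃q ε 0<ε) , λ n N≤n → upper (seq α n) ε (proj₂ (α≃q ε 0<ε) n N≤n)
  q≤α : ofℚ q ≤ℝ α
  q≤α ε 0<ε = proj₁ (α≃q ε 0<ε) , λ n N≤n → lower (seq α n) ε (proj₂ (α≃q ε 0<ε) n N≤n)
  0≤q : 0ℚ ≤ q
  0≤q = nonneg (≤-<-connex 0ℚ q)
    where
    nonneg : 0ℚ ≤ q ⊎ q < 0ℚ → 0ℚ ≤ q
    nonneg (inj₁ 0≤q) = 0≤q
    nonneg (inj₂ q<0) = contradiction (≤ℝ-≤-ofℚ {q} {0ℚ} {α} α≤q (ℚ.<⇒≤ q<0)) (<ℝ⇒≱ℝ {0ℝ} {α} 0<α)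
  module R = Rounding α 0<α α<1 (λ _ → q) (constℚ-computable q) (λ _ → ℚ.≤-refl) (λ _ → 0≤q) (λ _ → q≤α)
    0 (λ N → N , ℕ.≤-refl , ≤ℝ-≤-ofℚ {q} {q + ι 0 * (q - q)} {α} α≤q
      (ℚ.≤-reflexive (solve 2 (λ q z → q := q :+ z :* (q :- q)) refl q (ι 0))))

-- The irrational case

-- The ratio bound says p′ - p ≥ (1 - σ)(x - p), and multiplying by `C` recovers at least x - p.
gain : ∀ {x p p′ σ C} → p < x → 0ℚ ≤ C → 1ℚ ≤ C * (1ℚ - σ) →
  ℚ.∣ (x - p′) * recip (x - p) ∣ ≤ σ → x ≤ p + C * (p′ - p)
gain {x} {p} {p′} {σ} {C} p<x 0≤C 1≤Cτ ratio≤σ = by-gap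
  (0≤+ (0≤* 0≤C x-p′≤σw) (0≤* 0≤w (gap 1≤Cτ)))
  (solve 5 (λ x p p′ σ C → x :+ (C :* (σ :* (x :- p) :- (x :- p′)) :+ (x :- p) :* (C :* (con 1ℚ :- σ) :- con 1ℚ))
    := p :+ C :* (p′ :- p)) refl x p p′ σ C)
  where
  0≤w : 0ℚ ≤ x - p
  0≤w = gap (ℚ.<⇒≤ p<x)
  x-p′≤σw : 0ℚ ≤ σ * (x - p) - (x - p′)
  x-p′≤σw = subst (0ℚ ≤_)
    (trans (solve 4 (λ w v σ R → w :* (σ :- v :* R) := σ :* w :- v :* (w :* R)) refl (x - p) (x - p′) σ (recip (x - p)))
      (trans (cong (λ z → σ * (x - p) - (x - p′) * z) (recip-inverse (x - p) λ eq → ℚ.<⇒≢ (gap< p<x) (sym eq)))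
        (cong (λ z → σ * (x - p) - z) (ℚ.*-identityʳ (x - p′)))))
    (0≤* 0≤w (gap (ℚ.≤-trans (p≤∣p∣ ((x - p′) * recip (x - p))) ratio≤σ)))

irrational⇒test : ∀ α a ρ → 0ℝ <ℝ α → α <ℝ 1ℝ → IsLeftCEApproximation α a → ρ < 1ℚ →
  (irr : Irrational α) (f : ℕ → ℕ) → ComputableOrder f → LimInfAtMost (speedRatio α a irr f) ρ →
  BoundedIncrementTest α
irrational⇒test α a ρ 0<α α<1 leftCE ρ<1 irr f order (L , isLimInf , L≤ρ) =
  R.test , R.covered , R.bounded-increments
  where
  open IsLeftCEApproximation leftCE
  τ ε : ℚ
  -- Then σ = ρ + 2ε equals 1 - τ. One ε is spent on the liminf, the other on `L≤ρ`.
  τ = ½ * (1ℚ - ρ)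
  ε = ½ * τ
  0<τ : 0ℚ < τ
  0<τ = half-pos (1ℚ - ρ) (gap< ρ<1)
  0<ε : 0ℚ < ε
  0<ε = half-pos τ 0<τ
  c : ℕ
  c = proj₁ (archimedes τ 0<τ)
  -- The constant is `suc c`, since `widen` takes it in the form 1 + c.
  1≤Cτ : 1ℚ ≤ ι (suc c) * (1ℚ - (ρ + ε + ε))
  1≤Cτ = ℚ.≤-trans (proj₂ (archimedes τ 0<τ)) (subst (ι c * τ ≤_)
    (cong (ι (suc c) *_) (solve 1 (λ r → let t = con ½ :* (con 1ℚ :- r) in
      t := con 1ℚ :- (r :+ con ½ :* t :+ con ½ :* t)) refl ρ))
    (ℚ.*-monoʳ-≤-nonNeg τ {{ℚ.nonNegative (ℚ.<⇒≤ 0<τ)}} (ι-mono (ℕ.n≤1+n c))))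
  combine : ∀ v e l → 0ℚ < e → v + e ≤ l + ε → l ≤ ρ + ε → v ≤ ρ + ε + ε
  combine v e l 0<e h g = by-gap (0≤+ (0≤+ (ℚ.<⇒≤ 0<e) (gap h)) (gap g))
    (solve 5 (λ v e l r x → v :+ ((e :+ (l :+ x :- (v :+ e))) :+ (r :+ x :- l)) := r :+ x :+ x) refl v e l ρ ε)
  good : InfinitelyOften (λ s → α ≤ℝ ofℚ (a s + ι (suc c) * (a (f s) - a s)))
  good N = at (IsLimInf.infinitely-often-below isLimInf ε 0<ε N)
    where
    at : ∃[ s ] (N ℕ.≤ s × speedRatio α a irr f s <ℝ L +ℝ ofℚ ε) →
      ∃[ s ] (N ℕ.≤ s × α ≤ℝ ofℚ (a s + ι (suc c) * (a (f s) - a s)))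
    at (s , N≤s , e , 0<e , M , h) = s , N≤s , λ η 0<η → K , λ n K≤n → ℚ.≤-trans (bound n K≤n)
        (by-gap (ℚ.<⇒≤ 0<η) refl)
      where
      a<α : ofℚ (a s) <ℝ α
      a<α = leftCE-< leftCE irr s
      M₁ M₂ K : ℕ
      M₁ = proj₁ (proj₂ (proj₂ a<α))
      M₂ = proj₁ (L≤ρ ε 0<ε)
      K = M ℕ.⊔ M₁ ℕ.⊔ M₂
      bound : ∀ n → K ℕ.≤ n → seq α n ≤ a s + ι (suc c) * (a (f s) - a s)
      bound n K≤n = gain {seq α n} {a s} {a (f s)} {ρ + ε + ε} {ι (suc c)}
        (ℚ.<-≤-trans (by-gap< (proj₁ (proj₂ a<α)) refl)
          (proj₂ (proj₂ (proj₂ a<α)) n (ℕ.m⊔n≤o⇒n≤o M M₁ (ℕ.m⊔n≤o⇒m≤o (M ℕ.⊔ M₁) M₂ K≤n))))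
        (ι≥0 (suc c)) 1≤Cτ
        (combine (seq (speedRatio α a irr f s) n) e (seq L n) 0<e
          (h n (ℕ.m⊔n≤o⇒m≤o M M₁ (ℕ.m⊔n≤o⇒m≤o (M ℕ.⊔ M₁) M₂ K≤n)))
          (proj₂ (L≤ρ ε 0<ε) n (ℕ.m⊔n≤o⇒n≤o (M ℕ.⊔ M₁) M₂ K≤n)))
  module O = Orbit α a computable nondecreasing f (ComputableOrder.computable order)
    (ComputableOrder.nondecreasing order) c good
  a≤α : ∀ s → ofℚ (a s) ≤ℝ α
  a≤α s η 0<η = let e , 0<e , N , h = leftCE-< leftCE irr s in
    N , λ n N≤n → ℚ.≤-trans (by-gap (ℚ.<⇒≤ 0<e) refl) (ℚ.≤-trans (h n N≤n) (by-gap (ℚ.<⇒≤ 0<η) refl))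
  module R = Rounding α 0<α α<1 O.b O.b-computable O.b-step
    (λ i → proj₁ (IsApproximation.inUnitInterval isApproximation (O.orbit i))) (λ i → a≤α (O.orbit i))
    O.k O.good-b

speedable⇒test : ∀ α → 0ℝ <ℝ α → α <ℝ 1ℝ → LeftCESpeedable α → BoundedIncrementTest α
speedable⇒test α 0<α α<1 (a , leftCE , ρ , _ , ρ<1 , inj₁ rational) = rational⇒test α 0<α α<1 rational
speedable⇒test α 0<α α<1 (a , leftCE , ρ , _ , ρ<1 , inj₂ (irr , f , order , limInf)) =
  irrational⇒test α a ρ 0<α α<1 leftCE ρ<1 irr f order limInf

proposition4p5 : ExcludedMiddle 0ℓ → (α : ℝ) → 0ℝ <ℝ α → α <ℝ 1ℝ →
    LeftCESpeedable α ⇔ (Σ[ T ∈ SolovayTest ] (IsCoveredBy α T × HasBoundedIncrements T))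
proposition4p5 lem α 0<α α<1 = mk⇔ (speedable⇒test α 0<α α<1) (fromTest lem α)
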